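{- Let $k\ge 2$ be an integer. If $G$ is a $(2k+1)$-connected $(P_{3}\cup kP_{1})$-free graph with toughness $\tau(G)>1$, then $G$ is Hamiltonian-connected.
   Context: All graphs are finite, simple and undirected. The connectivity $\kappa(G)$ of a graph $G$ is the minimum size of a vertex set $S\subseteq V(G)$ such that $G-S$ is disconnected or has only one vertex; $G$ is $m$-connected if $\kappa(G)\ge m$. For a non-complete graph $G$, the toughness is $\tau(G)=\min\{|S|/c(G-S): S\subseteq V(G),\ c(G-S)\ge 2\}$, where $c(G-S)$ denotes the number of connected components of $G-S$; for complete graphs $\tau(G)=\infty$. $P_n$ denotes the path on $n$ vertices, $F_1\cup F_2$ denotes the disjoint union of vertex-disjoint graphs $F_1,F_2$, and $kP_1$ denotes $k$ disjoint copies of $P_1$ (so $P_3\cup kP_1$ is the disjoint union of a path on three vertices and $k$ isolated vertices). A graph $G$ is $F$-free if $G$ does not contain $F$ as an induced subgraph. A Hamiltonian path is a path that traverses every vertex of the graph exactly once. A graph $G$ is Hamiltonian-connected if for every pair of distinct vertices $u,v\in V(G)$ there is a Hamiltonian path of $G$ with endpoints $u$ and $v$. -}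

module Defs where

open import Data.Fin.Base using (Fin; toℕ)
import Data.Fin.Properties as Fin
open import Data.Fin.Subset using (Subset; _∈_; ∁; ∣_∣)
open import Data.Integer.Base using (+_)
open import Data.List.Base using (List; head; last)
import Data.List.Membership.Propositional as List
open import Data.List.Relation.Unary.Linked using (Linked)
open import Data.List.Relation.Unary.Unique.Propositional using (Unique)
open import Data.Maybe.Base using (just)
open import Data.Nat.Base using (ℕ; suc; _≤_; NonZero)
import Data.Nat.Properties as ℕ
open import Data.Product using (Σ; ∃-syntax; _×_; _,_; proj₁)
open import Data.Rational.Base as ℚ using (ℚ; _/_)
open import Data.Sum.Base using (_⊎_; inj₁; inj₂; swap)
open import Function.Base using (_on_)
open import Function.Bundles using (_⇔_)
open import Function.Definitions using (Injective; Surjective)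
open import Relation.Binary.Construct.Add.Supremum.Strict ℚ._<_ using (_<⁺_)
open import Relation.Binary.Construct.Closure.ReflexiveTransitive using (Star)
open import Relation.Binary.Core using (Rel)
open import Relation.Binary.Definitions using (Decidable; Symmetric)
open import Relation.Binary.PropositionalEquality using (_≡_; _≢_; sym)
open import Relation.Nullary using (¬_; no)
open import Relation.Nullary.Construct.Add.Supremum using (_⁺; [_]; ⊤⁺)
open import Relation.Nullary.Decidable using (map′; _×-dec_; _⊎-dec_)
open import Level using (0ℓ)

-- Finite graphs are those with V = Fin n.  Decidability of adjacency is
-- automatic classically.
record Graph (V : Set) : Set₁ where
  field
    Adj     : Rel V 0ℓ
    adj?    : Decidable Adj
    adj-sym : Symmetric Adj
    no-loop : ∀ {v} → ¬ Adj v v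

open Graph public

private variable
  n   : ℕ
  V W : Set

path : (n : ℕ) → Graph (Fin n)
path n .Adj i j = toℕ j ≡ suc (toℕ i) ⊎ toℕ i ≡ suc (toℕ j)
path n .adj? i j = (toℕ j ℕ.≟ suc (toℕ i)) ⊎-dec (toℕ i ℕ.≟ suc (toℕ j))
path n .adj-sym = swap
path n .no-loop (inj₁ e) = ℕ.1+n≢n (sym e)
path n .no-loop (inj₂ e) = ℕ.1+n≢n (sym e)

data UnionAdj (F : Graph V) (H : Graph W) : Rel (V ⊎ W) 0ℓ where
  left  : ∀ {u v} → Adj F u v → UnionAdj F H (inj₁ u) (inj₁ v)
  right : ∀ {u v} → Adj H u v → UnionAdj F H (inj₂ u) (inj₂ v)

infixr 5 _∪ᵍ_
_∪ᵍ_ : Graph V → Graph W → Graph (V ⊎ W)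
(F ∪ᵍ H) .Adj = UnionAdj F H
(F ∪ᵍ H) .adj? (inj₁ u) (inj₁ v) = map′ left (λ { (left a) → a }) (adj? F u v)
(F ∪ᵍ H) .adj? (inj₁ u) (inj₂ v) = no λ ()
(F ∪ᵍ H) .adj? (inj₂ u) (inj₁ v) = no λ ()
(F ∪ᵍ H) .adj? (inj₂ u) (inj₂ v) = map′ right (λ { (right a) → a }) (adj? H u v)
(F ∪ᵍ H) .adj-sym (left a)  = left (adj-sym F a)
(F ∪ᵍ H) .adj-sym (right a) = right (adj-sym H a)
(F ∪ᵍ H) .no-loop (left a)  = no-loop F a
(F ∪ᵍ H) .no-loop (right a) = no-loop H a

-- k vertex-disjoint copies of F; the vertex (i , v) is v in the i-th copy.
copies : (k : ℕ) → Graph V → Graph (Fin k × V)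
copies k F .Adj (i , u) (j , v) = i ≡ j × Adj F u v
copies k F .adj? (i , u) (j , v) = (i Fin.≟ j) ×-dec adj? F u v
copies k F .adj-sym (e , a) = sym e , adj-sym F a
copies k F .no-loop (_ , a) = no-loop F a

-- The vertices of G - S are taken in ∁ S rather than outside S because
-- membership proofs are unique, so each vertex occurs once.
infixl 6 _-_
_-_ : Graph (Fin n) → (S : Subset n) → Graph (∃[ v ] v ∈ ∁ S)
(G - S) .Adj = Adj G on proj₁
(G - S) .adj? u v = adj? G (proj₁ u) (proj₁ v)
(G - S) .adj-sym = adj-sym G
(G - S) .no-loop = no-loop G

record InducedEmbedding (F : Graph V) (G : Graph W) : Set where
  field
    embed     : V → W
    injective : Injective _≡_ _≡_ embed
    induced   : ∀ u v → Adj F u v ⇔ Adj G (embed u) (embed v)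

infix 4 _isFreeOf_
_isFreeOf_ : Graph W → Graph V → Set
G isFreeOf F = ¬ InducedEmbedding F G

Reachable : Graph V → Rel V 0ℓ
Reachable G = Star (Adj G)

Disconnected : Graph V → Set
Disconnected G = ∃[ u ] ∃[ v ] ¬ Reachable G u v

HasOneVertex : Graph V → Set
HasOneVertex {V} G = Σ V λ v → ∀ u → u ≡ v

Complete : Graph V → Set
Complete G = ∀ u v → u ≢ v → Adj G u v

-- c(G) = c: the classes of the reachability relation are in bijection
-- with Fin c.
record ComponentCount (G : Graph V) (c : ℕ) : Set where
  field
    component  : V → Fin c
    surjective : Surjective _≡_ _≡_ component
    classes    : ∀ u v → component u ≡ component v ⇔ Reachable G u v

IsMinimum : {A : Set} → Rel A 0ℓ → (A → Set) → A → Set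
IsMinimum _≼_ P m = P m × (∀ x → P x → m ≼ x)

CutSize : Graph (Fin n) → ℕ → Set
CutSize {n} G s = Σ (Subset n) λ S →
  s ≡ ∣ S ∣ × (Disconnected (G - S) ⊎ HasOneVertex (G - S))

-- κ(G) = κ
IsConnectivity : Graph (Fin n) → ℕ → Set
IsConnectivity G κ = IsMinimum _≤_ (CutSize G) κ

IsConnected : ℕ → Graph (Fin n) → Set
IsConnected m G = ∃[ κ ] IsConnectivity G κ × m ≤ κ

data CutRatio (G : Graph (Fin n)) : ℚ → Set where
  cutRatio : (S : Subset n) (c : ℕ) .{{_ : NonZero c}} →
             ComponentCount (G - S) c → 2 ≤ c → CutRatio G (+ ∣ S ∣ / c)

-- τ(G) = t, with values in ℚ ∪ {∞}, where ∞ is ⊤⁺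
data IsToughness (G : Graph (Fin n)) : ℚ ⁺ → Set where
  complete    : Complete G → IsToughness G ⊤⁺
  nonComplete : ∀ {t} → ¬ Complete G → IsMinimum ℚ._≤_ (CutRatio G) t →
                IsToughness G [ t ]

ToughnessGreaterThan : ℚ → Graph (Fin n) → Set
ToughnessGreaterThan q G = ∃[ t ] IsToughness G t × [ q ] <⁺ t

record HamiltonianPath (G : Graph V) (u v : V) : Set where
  field
    vertices : List V
    linked   : Linked (Adj G) vertices
    starts   : head vertices ≡ just u
    ends     : last vertices ≡ just v
    unique   : Unique vertices
    spanning : ∀ w → w List.∈ vertices

HamiltonianConnected : Graph V → Set
HamiltonianConnected G = ∀ u v → u ≢ v → HamiltonianPath G u v

{-# OPTIONS --safe #-}
-- Let p 0, …, p L be a longest path from u to v, and suppose h lies off it, in the component H of G - p.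
-- By connectivity H is attached to at least 2k positions t < L.  Maximality makes
-- A = {h} ∪ {p (t + 1) : t attached, t < L} independent.  Call a vertex a hub if it has two neighbours in A.
-- As G is (P₃ ∪ kP₁)-free, a hub misses fewer than k vertices of A, and deleting the set S of hubs leaves a
-- disjoint union of cliques.  Maximality again puts every hub on the path.  Any two hubs have two common
-- neighbours p (i + 1), p (j + 1) in A; if the hubs are p (b + 1), p (c + 1) with p b adjacent to p c, then for
-- each relative order of b, c, i, j the path can be rerouted through H and so be lengthened.  Hence the
-- predecessors of the hubs, with h standing in for the predecessor of p 0, are pairwise nonadjacent non-hubs,
-- so they lie in distinct components of G - S: there are at least |S| components, contradicting toughness > 1.
module Submission where

open import Algebra.Solver.CommutativeMonoid as CMSolver using ()
open import Data.Bool.Base using (true; false)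
open import Data.Empty using (⊥; ⊥-elim)
open import Data.Fin.Base using (Fin; zero; suc; inject≤)
import Data.Fin.Properties as Fin
open import Data.Fin.Subset as Subset using (Subset; inside; outside; _∈_; _∉_; ∁; ∣_∣)
open import Data.Fin.Subset.Properties using (∉⊥; ∣⊥∣≡0; x∈∁p⇒x∉p; x∉p⇒x∈∁p)
import Data.Integer.Base as ℤ
import Data.Integer.Properties as ℤ
open import Data.List.Base using (List; []; _∷_; _++_; length; filter; lookup; map; reverse; head; last; allFin)
open import Data.List.Membership.DecPropositional using () renaming (_∈?_ to _∈ˡ?_)
open import Data.List.Membership.Propositional using (find; lose) renaming (_∈_ to _∈ˡ_)
open import Data.List.Membership.Propositional.Properties using (∈-lookup; ∈-filter⁻; ∈-map⁻)
import Data.List.Properties as List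
open import Data.List.Relation.Binary.Permutation.Propositional using (_↭_; ↭-refl; ↭-trans; ↭-sym; ↭-reflexive; ↭⇒↭ₛ)
open import Data.List.Relation.Binary.Permutation.Propositional.Properties using (++-commutativeMonoid; ↭-reverse; ↭-length; ++⁺)
import Data.List.Relation.Binary.Permutation.Setoid.Properties as ↭ₛ
open import Data.List.Relation.Unary.All as All using ([]; _∷_)
open import Data.List.Relation.Unary.AllPairs as AllPairs using (AllPairs; []; _∷_)
open import Data.List.Relation.Unary.Any as Any using (Any; here; there)
import Data.List.Relation.Unary.Any.Properties as Any
open import Data.List.Relation.Unary.Linked as Linked using (Linked; [-]; _∷_)
open import Data.List.Relation.Unary.Unique.Propositional using (Unique)
import Data.List.Relation.Unary.Unique.Propositional.Properties as Unique
open import Data.Maybe.Base using (just)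
import Data.Maybe.Properties as Maybe
open import Data.Nat.Base using (ℕ; zero; suc; _+_; _*_; _∸_; _≤_; _<_; z≤n; s≤s; NonZero; >-nonZero)
import Data.Nat.Properties as ℕ
open import Data.Product using (∃-syntax; _×_; _,_; proj₁; proj₂)
open import Data.Rational.Base as ℚ using (1ℚ; _/_)
import Data.Rational.Properties as ℚ
import Data.Rational.Unnormalised.Base as ℚᵘ
import Data.Rational.Unnormalised.Properties as ℚᵘ
open import Data.Sum.Base using (_⊎_; inj₁; inj₂)
open import Data.Vec.Base as Vec using ([]; _∷_; here; there)
open import Data.Vec.Properties using (lookup∘tabulate; []=⇒lookup; lookup⇒[]=)
open import Data.Vec.Properties.WithK using ([]=-irrelevant)
open import Function.Base using (_∘_; id)
open import Function.Bundles using (mk⇔; Equivalence)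
open import Function.Definitions using (Injective)
open import Level using (0ℓ)
open import Relation.Binary.Construct.Add.Supremum.Strict ℚ._<_ using ([_])
open import Relation.Binary.Construct.Closure.ReflexiveTransitive as Star using (Star; ε; _◅_; _◅◅_)
open import Relation.Binary.Core using (Rel)
open import Relation.Binary.Definitions using (tri<; tri≈; tri>)
open import Relation.Binary.PropositionalEquality using (_≡_; _≢_; refl; sym; trans; cong; subst; subst₂; setoid; module ≡-Reasoning)
open import Relation.Nullary using (¬_; Dec; yes; no; _because_; contradiction; ¬?; does)
open import Relation.Nullary.Decidable using (map′; _×-dec_; _⊎-dec_; dec-true; ¬¬-excluded-middle)
open import Relation.Unary using (Pred; Decidable)
open import Defs

private variable
  n k : ℕ
  A V : Set

-- Counting in duplicate-free lists and finite subsets.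

length≤1 : {xs : List A} → Unique xs → (∀ {x y} → x ∈ˡ xs → y ∈ˡ xs → x ≡ y) → length xs ≤ 1
length≤1 {xs = []}         _              _   = z≤n
length≤1 {xs = _ ∷ []}     _              _   = s≤s z≤n
length≤1 {xs = _ ∷ _ ∷ _}  ((x≢y ∷ _) ∷ _) one =
  contradiction (one (here refl) (there (here refl))) x≢y

module _ {P : Pred A 0ℓ} (P? : Decidable P) where

  length-filter-¬ : ∀ xs → length (filter P? xs) + length (filter (¬? ∘ P?) xs) ≡ length xs
  length-filter-¬ [] = refl
  length-filter-¬ (x ∷ xs) with P? x
  ... | true  because _ = cong suc (length-filter-¬ xs)
  ... | false because _ = trans (ℕ.+-suc _ _) (cong suc (length-filter-¬ xs))

discard-one : {P : Pred A 0ℓ} (P? : Decidable P) {xs : List A} → Unique xs →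
  (∀ {x y} → x ∈ˡ xs → y ∈ˡ xs → P x → P y → x ≡ y) →
  length xs ≤ suc (length (filter (¬? ∘ P?) xs))
discard-one P? {xs} u one = ℕ.≤-trans (ℕ.≤-reflexive (sym (length-filter-¬ P? xs)))
  (ℕ.+-monoˡ-≤ _ (length≤1 (Unique.filter⁺ P? u) (λ x∈ y∈ →
    let x∈xs , Px = ∈-filter⁻ P? x∈ ; y∈xs , Py = ∈-filter⁻ P? y∈ in one x∈xs y∈xs Px Py)))

-- `AllPairs` compares an entry only with later ones, so symmetry covers the other order. Taken with
-- equality this gives injectivity of `lookup`; taken with reachability it separates components.
lookup-apart : {R : Rel A 0ℓ} → (∀ {x y} → R x y → R y x) → {xs : List A} →
  AllPairs (λ x y → ¬ R x y) xs → ∀ i j → R (lookup xs i) (lookup xs j) → i ≡ j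
lookup-apart _ {_ ∷ _}  (_ ∷ _)  zero    zero    _ = refl
lookup-apart _ {_ ∷ xs} (ap ∷ _) zero    (suc j) r = contradiction r (All.lookup ap (∈-lookup {xs = xs} j))
lookup-apart s {_ ∷ xs} (ap ∷ _) (suc i) zero    r = contradiction (s r) (All.lookup ap (∈-lookup {xs = xs} i))
lookup-apart s {_ ∷ _}  (_ ∷ aps) (suc i) (suc j) r = cong suc (lookup-apart s aps i j r)

lookup-injective : {xs : List A} → Unique xs → Injective _≡_ _≡_ (lookup xs)
lookup-injective u = lookup-apart sym u _ _

unique⇒length≤n : {xs : List (Fin n)} → Unique xs → length xs ≤ n
unique⇒length≤n u = Fin.injective⇒≤ (lookup-injective u)

elements : (S : Subset n) → Fin ∣ S ∣ → Fin n
elements (inside  ∷ S) zero    = zero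
elements (inside  ∷ S) (suc i) = suc (elements S i)
elements (outside ∷ S) i       = suc (elements S i)

elements-∈ : (S : Subset n) (i : Fin ∣ S ∣) → elements S i ∈ S
elements-∈ (inside  ∷ S) zero    = here
elements-∈ (inside  ∷ S) (suc i) = there (elements-∈ S i)
elements-∈ (outside ∷ S) i       = there (elements-∈ S i)

elements-injective : (S : Subset n) → Injective _≡_ _≡_ (elements S)
elements-injective (inside  ∷ S) {zero}  {zero}  _  = refl
elements-injective (inside  ∷ S) {suc i} {suc j} eq = cong suc (elements-injective S (Fin.suc-injective eq))
elements-injective (outside ∷ S) eq = elements-injective S (Fin.suc-injective eq)

module _ {P : Pred (Fin n) 0ℓ} (P? : Decidable P) where

  comprehension : Subset n
  comprehension = Vec.tabulate (does ∘ P?)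

  ∈-comprehension⁺ : ∀ {v} → P v → v ∈ comprehension
  ∈-comprehension⁺ {v} Pv = lookup⇒[]= v _ (trans (lookup∘tabulate _ v) (dec-true (P? v) Pv))

  ∈-comprehension⁻ : ∀ {v} → v ∈ comprehension → P v
  ∈-comprehension⁻ {v} v∈ with P? v | trans (sym (lookup∘tabulate (does ∘ P?) v)) ([]=⇒lookup v∈)
  ... | yes Pv | _ = Pv
  ... | no _   | ()

-- Finite searches and decidability.

-- Finitely many instances of excluded middle combine under a double negation. This is enough for
-- attachment to a component, which is only used on the way to a contradiction.
¬¬-decidable : ∀ {n} (P : Pred (Fin n) 0ℓ) → ¬ ¬ Decidable P
¬¬-decidable {zero}  P ¬dec = ¬dec λ ()
¬¬-decidable {suc n} P ¬dec = ¬¬-excluded-middle λ P₀? → ¬¬-decidable (P ∘ suc) λ Pₛ? →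
  ¬dec λ { zero → P₀? ; (suc i) → Pₛ? i }

anyList≤? : ∀ m {Q : Pred (List (Fin n)) 0ℓ} → Decidable Q → Dec (∃[ xs ] length xs ≤ m × Q xs)
anyList≤? zero Q? = map′ (λ q → [] , z≤n , q) (λ { ([] , _ , q) → q }) (Q? [])
anyList≤? (suc m) Q? = map′
  (λ { (inj₁ q) → [] , z≤n , q ; (inj₂ (x , xs , l , q)) → x ∷ xs , s≤s l , q })
  (λ { ([] , _ , q) → inj₁ q ; (x ∷ xs , s≤s l , q) → inj₂ (x , xs , l , q) })
  (Q? [] ⊎-dec Fin.any? (λ x → anyList≤? m (Q? ∘ (x ∷_))))

-- A duplicate-free list over `Fin n` has length at most `n`, so the search is finite. Having a
-- decision makes the final argument by contradiction constructive.
hamiltonianPath? : (G : Graph (Fin n)) (u v : Fin n) → Dec (HamiltonianPath G u v)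
hamiltonianPath? {n} G u v = map′
  (λ (xs , _ , l , s , e , un , sp) → record
    { vertices = xs ; linked = l ; starts = s ; ends = e ; unique = un ; spanning = sp })
  (λ H → let open HamiltonianPath H in
    vertices , unique⇒length≤n unique , linked , starts , ends , unique , spanning)
  (anyList≤? n (λ xs →
    Linked.linked? (adj? G) xs ×-dec Maybe.≡-dec Fin._≟_ (head xs) (just u) ×-dec
    Maybe.≡-dec Fin._≟_ (last xs) (just v) ×-dec AllPairs.allPairs? (λ x y → ¬? (x Fin.≟ y)) xs ×-dec
    Fin.all? (λ w → Any.any? (w Fin.≟_) xs)))

-- Components of a vertex-deleted graph.

module _ {R : Rel A 0ℓ} (R? : ∀ x y → Dec (R x y)) where

  representatives : List A → List A
  representatives [] = []
  representatives (x ∷ xs) with Any.any? (R? x) (representatives xs)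
  ... | yes _ = representatives xs
  ... | no  _ = x ∷ representatives xs

  representatives-cover : (∀ {x} → R x x) → ∀ {x xs} → x ∈ˡ xs → Any (R x) (representatives xs)
  representatives-cover r {xs = y ∷ ys} x∈ with Any.any? (R? y) (representatives ys) | x∈
  ... | yes p | here refl = p
  ... | yes _ | there m   = representatives-cover r m
  ... | no _  | here refl = here r
  ... | no _  | there m   = there (representatives-cover r m)

  representatives-apart : ∀ xs → AllPairs (λ x y → ¬ R x y) (representatives xs)
  representatives-apart [] = []
  representatives-apart (x ∷ xs) with Any.any? (R? x) (representatives xs)
  ... | yes _ = representatives-apart xs
  ... | no ¬p = All.tabulate (λ y∈ r → ¬p (lose y∈ r)) ∷ representatives-apart xs

outsideList : (S : Subset n) → ∃[ xs ] (∀ (v : ∃[ v ] v ∈ ∁ S) → v ∈ˡ xs)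
outsideList [] = [] , λ { (() , _) }
outsideList (outside ∷ S) with xs , cover ← outsideList S =
  (zero , here) ∷ map (λ (v , v∈) → suc v , there v∈) xs ,
  λ { (zero , here) → here refl
    ; (suc v , there v∈) → there (Any.map⁺ (Any.map (cong (λ (v , v∈) → suc v , there v∈)) (cover (v , v∈)))) }
outsideList (inside ∷ S) with xs , cover ← outsideList S =
  map (λ (v , v∈) → suc v , there v∈) xs ,
  λ { (suc v , there v∈) → Any.map⁺ (Any.map (cong (λ (v , v∈) → suc v , there v∈)) (cover (v , v∈))) }

-- A component is numbered by the position of its representative in a list of pairwise unreachable
-- vertices.
componentCount : (G : Graph (Fin n)) (S : Subset n) →
  (∀ x y → Dec (Reachable (G - S) x y)) → ∃[ c ] ComponentCount (G - S) c
componentCount G S R? = length reps , record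
  { component  = comp
  ; surjective = λ i → lookup reps i , λ { refl → lookup-apart sy apart _ i (sy (rep (lookup reps i))) }
  ; classes    = λ x y → mk⇔
      (λ eq → tr (rep x) (subst (λ i → Reachable (G - S) (lookup reps i) y) (sym eq) (sy (rep y))))
      (λ r → lookup-apart sy apart _ _ (tr (sy (rep x)) (tr r (rep y)))) }
  where
  sy : ∀ {x y} → Reachable (G - S) x y → Reachable (G - S) y x
  sy = Star.reverse (adj-sym G)
  tr : ∀ {x y z} → Reachable (G - S) x y → Reachable (G - S) y z → Reachable (G - S) x z
  tr = _◅◅_
  all = outsideList S
  reps = representatives R? (proj₁ all)
  apart = representatives-apart R? (proj₁ all)
  cover : ∀ x → Any (Reachable (G - S) x) reps
  cover x = representatives-cover R? ε (proj₂ all x)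
  comp : ∀ x → Fin (length reps)
  comp x = Any.index (cover x)
  rep : ∀ x → Reachable (G - S) x (lookup reps (comp x))
  rep x = Any.lookup-index (cover x)

-- Consequences of toughness greater than 1.

1</⇒< : ∀ s c .{{_ : NonZero c}} → 1ℚ ℚ.< ℤ.+ s / c → c < s
1</⇒< s (suc c) 1<s/c = ℤ.drop‿+<+ (subst₂ ℤ._<_ (ℤ.*-identityˡ (ℤ.+ suc c)) (ℤ.*-identityʳ (ℤ.+ s)) (ℚᵘ.drop-*<* 1<ᵘ))
  where
  1<ᵘ : ℚᵘ.1ℚᵘ ℚᵘ.< ℚᵘ.mkℚᵘ (ℤ.+ s) c
  -- `/` reduces the fraction; `s` and `c` are recovered from the equivalent unnormalised rational.
  1<ᵘ = ℚᵘ.<-respʳ-≃ (ℚ.toℚᵘ-fromℚᵘ (ℚᵘ.mkℚᵘ (ℤ.+ s) c)) (ℚ.toℚᵘ-mono-< 1<s/c)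

module _ (G : Graph (Fin n)) where

  -- The pair `a`, `b` excludes the complete case, where the toughness is infinite and bounds
  -- nothing.
  tough⇒components<∣S∣ : ToughnessGreaterThan 1ℚ G → ∀ {a b} → a ≢ b → ¬ Adj G a b → ∀ S {c} → ComponentCount (G - S) c → 2 ≤ c → c < ∣ S ∣
  tough⇒components<∣S∣ (_ , complete K , _) a≢b ¬ab S cc 2≤c = contradiction (K _ _ a≢b) ¬ab
  tough⇒components<∣S∣ (_ , nonComplete _ (_ , min) , [ 1<t ]) a≢b ¬ab S cc 2≤c =
    1</⇒< ∣ S ∣ _ (ℚ.<-≤-trans 1<t (min _ (cutRatio S _ cc 2≤c)))
    where instance _ = >-nonZero (ℕ.≤-trans (s≤s z≤n) 2≤c)

  Apart : Rel (Fin n) 0ℓ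
  Apart x y = x ≢ y × ¬ Adj G x y

  module _ (S : Subset n)
    (cliques : ∀ {x y z} → x ∉ S → y ∉ S → z ∉ S → Adj G x y → Adj G y z → x ≢ z → Adj G x z) where

    private
      -- Transitivity of adjacency outside `S` contracts a walk to a single edge, so components of
      -- `G - S` are cliques.
      reachable⇒ : ∀ {x y} → Reachable (G - S) x y → proj₁ x ≡ proj₁ y ⊎ Adj G (proj₁ x) (proj₁ y)
      reachable⇒ ε = inj₁ refl
      reachable⇒ {x} {y} (_◅_ {j = z} xz r) with reachable⇒ r
      ... | inj₁ refl = inj₂ xz
      ... | inj₂ zy with proj₁ x Fin.≟ proj₁ y
      ...   | yes eq = inj₁ eq
      ...   | no x≢y = inj₂ (cliques (x∈∁p⇒x∉p (proj₂ x)) (x∈∁p⇒x∉p (proj₂ z)) (x∈∁p⇒x∉p (proj₂ y)) xz zy x≢y)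

      ⇒reachable : ∀ {x y} → proj₁ x ≡ proj₁ y ⊎ Adj G (proj₁ x) (proj₁ y) → Reachable (G - S) x y
      -- The two vertices could differ only in their membership proofs, which are unique.
      ⇒reachable {x , p} {.x , q} (inj₁ refl) rewrite []=-irrelevant p q = ε
      ⇒reachable (inj₂ a) = a ◅ ε

    -- Members of the family lie in distinct cliques of `G - S`, so `m` is at most the number of
    -- components. The pair `a`, `b` secures the two components that toughness asks for, even when
    -- `m < 2`.
    apart-family<∣S∣ : ToughnessGreaterThan 1ℚ G → ∀ {a b} → a ∉ S → b ∉ S → Apart a b → ∀ {m} (f : Fin m → Fin n) → (∀ i → f i ∉ S) →
      (∀ {i j} → i ≢ j → Apart (f i) (f j)) → m < ∣ S ∣
    apart-family<∣S∣ tough {a} {b} a∉ b∉ (a≢b , ¬ab) f f∉ f-apart = ℕ.≤-<-trans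
      (Fin.injective⇒≤ {f = component ∘ f′} inj)
      (tough⇒components<∣S∣ tough a≢b ¬ab S (proj₂ cc) (two _ (component (a , x∉p⇒x∈∁p a∉)) (component (b , x∉p⇒x∈∁p b∉))
        (λ eq → separate (a≢b , ¬ab) eq)))
      where
      cc = componentCount G S λ x y → map′ ⇒reachable reachable⇒ ((_ Fin.≟ _) ⊎-dec adj? G _ _)
      open ComponentCount (proj₂ cc)
      f′ : _ → ∃[ v ] v ∈ ∁ S
      f′ i = f i , x∉p⇒x∈∁p (f∉ i)
      separate : ∀ {x y} → Apart (proj₁ x) (proj₁ y) → component x ≢ component y
      separate {x} {y} (x≢y , ¬xy) eq with reachable⇒ (Equivalence.to (classes x y) eq)
      ... | inj₁ e = x≢y e
      ... | inj₂ e = ¬xy e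
      inj : Injective _≡_ _≡_ (component ∘ f′)
      inj {i} {j} eq with i Fin.≟ j
      ... | yes e = e
      ... | no i≢j = contradiction eq (separate (f-apart i≢j))
      two : ∀ m (i j : Fin m) → i ≢ j → 2 ≤ m
      two (suc zero) zero zero ne = contradiction refl ne
      two (suc (suc _)) _ _ _ = s≤s (s≤s z≤n)

-- The forbidden subgraph and hubs.

module _ (G : Graph (Fin n)) (free : G isFreeOf (path 3 ∪ᵍ copies k (path 1))) where

  -- Otherwise the first `k` entries of `bs`, together with the induced path `x`, `y`, `z`, form the
  -- forbidden subgraph.
  P₃-free-of-independent : ∀ {x y z} → Adj G x y → Adj G y z → Apart G x z → ∀ {bs} → Unique bs →
    (∀ {a b} → a ∈ˡ bs → b ∈ˡ bs → ¬ Adj G a b) →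
    (∀ {b} → b ∈ˡ bs → Apart G x b × Apart G y b × Apart G z b) → length bs < k
  P₃-free-of-independent {x} {y} {z} xy yz (x≢z , ¬xz) {bs} bs! indep far = ℕ.≰⇒> λ k≤ → free (embedding k≤)
    where
    x≢y : x ≢ y
    x≢y refl = no-loop G xy
    y≢z : y ≢ z
    y≢z refl = no-loop G yz
    p₃ : Fin 3 → Fin n
    p₃ zero             = x
    p₃ (suc zero)       = y
    p₃ (suc (suc zero)) = z
    p₃-far : ∀ i {b} → b ∈ˡ bs → Apart G (p₃ i) b
    p₃-far zero             b∈ = proj₁ (far b∈)
    p₃-far (suc zero)       b∈ = proj₁ (proj₂ (far b∈))
    p₃-far (suc (suc zero)) b∈ = proj₂ (proj₂ (far b∈))
    p₃-injective : ∀ i j → p₃ i ≡ p₃ j → i ≡ j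
    p₃-injective zero             zero             _ = refl
    p₃-injective zero             (suc zero)       e = contradiction e x≢y
    p₃-injective zero             (suc (suc zero)) e = contradiction e x≢z
    p₃-injective (suc zero)       zero             e = contradiction (sym e) x≢y
    p₃-injective (suc zero)       (suc zero)       _ = refl
    p₃-injective (suc zero)       (suc (suc zero)) e = contradiction e y≢z
    p₃-injective (suc (suc zero)) zero             e = contradiction (sym e) x≢z
    p₃-injective (suc (suc zero)) (suc zero)       e = contradiction (sym e) y≢z
    p₃-injective (suc (suc zero)) (suc (suc zero)) _ = refl
    p₃-to : ∀ i j → Adj (path 3) i j → Adj G (p₃ i) (p₃ j)
    p₃-to zero             zero             (inj₁ ())
    p₃-to zero             zero             (inj₂ ())
    p₃-to zero             (suc zero)       _ = xy
    p₃-to zero             (suc (suc zero)) (inj₁ ())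
    p₃-to zero             (suc (suc zero)) (inj₂ ())
    p₃-to (suc zero)       zero             _ = adj-sym G xy
    p₃-to (suc zero)       (suc zero)       (inj₁ ())
    p₃-to (suc zero)       (suc zero)       (inj₂ ())
    p₃-to (suc zero)       (suc (suc zero)) _ = yz
    p₃-to (suc (suc zero)) zero             (inj₁ ())
    p₃-to (suc (suc zero)) zero             (inj₂ ())
    p₃-to (suc (suc zero)) (suc zero)       _ = adj-sym G yz
    p₃-to (suc (suc zero)) (suc (suc zero)) (inj₁ ())
    p₃-to (suc (suc zero)) (suc (suc zero)) (inj₂ ())
    p₃-from : ∀ i j → Adj G (p₃ i) (p₃ j) → Adj (path 3) i j
    p₃-from zero             zero             a = contradiction a (no-loop G)
    p₃-from zero             (suc zero)       _ = inj₁ refl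
    p₃-from zero             (suc (suc zero)) a = contradiction a ¬xz
    p₃-from (suc zero)       zero             _ = inj₂ refl
    p₃-from (suc zero)       (suc zero)       a = contradiction a (no-loop G)
    p₃-from (suc zero)       (suc (suc zero)) _ = inj₁ refl
    p₃-from (suc (suc zero)) zero             a = contradiction (adj-sym G a) ¬xz
    p₃-from (suc (suc zero)) (suc zero)       _ = inj₂ refl
    p₃-from (suc (suc zero)) (suc (suc zero)) a = contradiction a (no-loop G)
    embedding : k ≤ length bs → InducedEmbedding (path 3 ∪ᵍ copies k (path 1)) G
    embedding k≤ = record
      { embed     = embed
      ; injective = λ {s} {t} → inj s t
      ; induced   = λ s t → mk⇔ (to s t) (from s t) }
      where
      b : Fin k → Fin n
      b i = lookup bs (inject≤ i k≤)
      b∈ : ∀ i → b i ∈ˡ bs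
      b∈ i = ∈-lookup (inject≤ i k≤)
      embed : Fin 3 ⊎ (Fin k × Fin 1) → Fin n
      embed (inj₁ i)       = p₃ i
      embed (inj₂ (i , _)) = b i
      inj : ∀ s t → embed s ≡ embed t → s ≡ t
      inj (inj₁ i)          (inj₁ j)          e = cong inj₁ (p₃-injective i j e)
      inj (inj₁ i)          (inj₂ (j , _))    e = contradiction e (proj₁ (p₃-far i (b∈ j)))
      inj (inj₂ (i , _))    (inj₁ j)          e = contradiction (sym e) (proj₁ (p₃-far j (b∈ i)))
      inj (inj₂ (i , zero)) (inj₂ (j , zero)) e =
        cong (λ i → inj₂ (i , zero)) (Fin.inject≤-injective k≤ k≤ i j (lookup-injective bs! e))
      to : ∀ s t → UnionAdj (path 3) (copies k (path 1)) s t → Adj G (embed s) (embed t)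
      to _ _ (left {i} {j} a) = p₃-to i j a
      to _ _ (right {_ , zero} {_ , zero} (_ , inj₁ ()))
      to _ _ (right {_ , zero} {_ , zero} (_ , inj₂ ()))
      from : ∀ s t → Adj G (embed s) (embed t) → UnionAdj (path 3) (copies k (path 1)) s t
      from (inj₁ i)       (inj₁ j)       a = left (p₃-from i j a)
      from (inj₁ i)       (inj₂ (j , _)) a = contradiction a (proj₂ (p₃-far i (b∈ j)))
      from (inj₂ (i , _)) (inj₁ j)       a = contradiction (adj-sym G a) (proj₂ (p₃-far j (b∈ i)))
      from (inj₂ (i , _)) (inj₂ (j , _)) a = contradiction a (indep (b∈ i) (b∈ j))

Hub : Graph (Fin n) → List (Fin n) → Pred (Fin n) 0ℓ
Hub G A v = Any (λ a → Any (λ b → a ≢ b × Adj G v a × Adj G v b) A) A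

module _ (G : Graph (Fin n)) (A : List (Fin n)) where

  hub? : Decidable (Hub G A)
  hub? v = Any.any? (λ a → Any.any? (λ b → ¬? (a Fin.≟ b) ×-dec adj? G v a ×-dec adj? G v b) A) A

  hub⁺ : ∀ {v a b} → a ∈ˡ A → b ∈ˡ A → a ≢ b → Adj G v a → Adj G v b → Hub G A v
  hub⁺ a∈ b∈ a≢b va vb = lose a∈ (lose b∈ (a≢b , va , vb))

  hub⁻ : ∀ {v} → Hub G A v → ∃[ a ] ∃[ b ] a ∈ˡ A × b ∈ˡ A × a ≢ b × Adj G v a × Adj G v b
  hub⁻ hub with a , a∈ , any ← find hub with b , b∈ , p ← find any = a , b , a∈ , b∈ , p

  module _ (free : G isFreeOf (path 3 ∪ᵍ copies k (path 1)))
    (A! : Unique A) (indep : ∀ {a b} → a ∈ˡ A → b ∈ˡ A → ¬ Adj G a b) where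

    -- Two neighbours `a`, `b` of `v` in the independent set `A` make `a`, `v`, `b` an induced path,
    -- and the non-neighbours of `v` in `A` serve as the isolated vertices.
    hub-nonneighbours<k : ∀ {v} → Hub G A v → length (filter (¬? ∘ adj? G v) A) < k
    hub-nonneighbours<k {v} hub with a , b , a∈ , b∈ , a≢b , va , vb ← hub⁻ hub =
      P₃-free-of-independent G free (adj-sym G va) vb (a≢b , indep a∈ b∈) (Unique.filter⁺ _ A!)
        (λ x∈ y∈ → indep (proj₁ (split x∈)) (proj₁ (split y∈)))
        (λ x∈ → let x∈A , ¬vx = split x∈ in
          ((λ { refl → ¬vx va }) , indep a∈ x∈A) ,
          -- `v` is a non-neighbour of itself, but `v` in `A` would give the edge `va` inside `A`.
          ((λ { refl → indep x∈A a∈ va }) , ¬vx) ,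
          ((λ { refl → ¬vx vb }) , indep b∈ x∈A))
      where
      split : ∀ {x} → x ∈ˡ filter (¬? ∘ adj? G v) A → x ∈ˡ A × ¬ Adj G v x
      split = ∈-filter⁻ (¬? ∘ adj? G v)

    module _ (2≤k : 2 ≤ k) (2k<∣A∣ : 2 * k < length A) where

      -- Outside the hubs, the closed neighbourhood of a vertex contains at most one element of A.
      nonhubs-transitive : ∀ {x y z} → ¬ Hub G A x → ¬ Hub G A y → ¬ Hub G A z →
        Adj G x y → Adj G y z → x ≢ z → Adj G x z
      nonhubs-transitive {x} {y} {z} ¬hx ¬hy ¬hz xy yz x≢z with adj? G x z
      ... | yes xz = xz
      -- Here `x`, `y`, `z` would be an induced path. Each of the three is close to at most one
      -- element of `A`; the rest, `D`, supplies the isolated vertices.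
      ... | no ¬xz = contradiction
        (P₃-free-of-independent G free xy yz (x≢z , ¬xz) D!
          (λ a∈ b∈ → indep (D⊆A a∈) (D⊆A b∈))
          (λ d∈ → far x (proj₂ (split x B (proj₁ (split y C (proj₁ (split z C′ d∈))))))
                , far y (proj₂ (split y C (proj₁ (split z C′ d∈))))
                , far z (proj₂ (split z C′ d∈))))
        (ℕ.≤⇒≯ k≤∣D∣)
        where
        Close : Fin n → Pred (Fin n) 0ℓ
        Close v a = v ≡ a ⊎ Adj G v a
        close? : ∀ v → Decidable (Close v)
        close? v a = (v Fin.≟ a) ⊎-dec adj? G v a
        avoid : Fin n → List (Fin n) → List (Fin n)
        avoid v = filter (¬? ∘ close? v)
        split : ∀ v B {a} → a ∈ˡ avoid v B → a ∈ˡ B × ¬ Close v a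
        split v B = ∈-filter⁻ (¬? ∘ close? v) {xs = B}
        far : ∀ v {a} → ¬ Close v a → Apart G v a
        far v ¬c = (λ e → ¬c (inj₁ e)) , (λ e → ¬c (inj₂ e))
        one : ∀ {v} → ¬ Hub G A v → ∀ {a b} → a ∈ˡ A → b ∈ˡ A → Close v a → Close v b → a ≡ b
        one ¬h a∈ b∈ (inj₁ refl) (inj₁ refl) = refl
        one ¬h a∈ b∈ (inj₁ refl) (inj₂ vb)   = contradiction vb (indep a∈ b∈)
        one ¬h a∈ b∈ (inj₂ va)   (inj₁ refl) = contradiction va (indep b∈ a∈)
        one ¬h {a} {b} a∈ b∈ (inj₂ va) (inj₂ vb) with a Fin.≟ b
        ... | yes e   = e
        ... | no a≢b = contradiction (hub⁺ a∈ b∈ a≢b va vb) ¬h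
        B = A
        C = avoid x B
        C′ = avoid y C
        D = avoid z C′
        C! : Unique C
        C! = Unique.filter⁺ _ A!
        C′! : Unique C′
        C′! = Unique.filter⁺ _ C!
        D! : Unique D
        D! = Unique.filter⁺ _ C′!
        C′⊆A : ∀ {a} → a ∈ˡ C′ → a ∈ˡ A
        C′⊆A a∈ = proj₁ (split x B (proj₁ (split y C a∈)))
        D⊆A : ∀ {a} → a ∈ˡ D → a ∈ˡ A
        D⊆A a∈ = C′⊆A (proj₁ (split z C′ a∈))
        2k<3+∣D∣ : 2 * k < 3 + length D
        2k<3+∣D∣ = ℕ.≤-trans 2k<∣A∣ (ℕ.≤-trans
          (discard-one (close? x) A! (one ¬hx)) (s≤s (ℕ.≤-trans
          (discard-one (close? y) C! (λ a∈ b∈ → one ¬hy (proj₁ (split x B a∈)) (proj₁ (split x B b∈)))) (s≤s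
          (discard-one (close? z) C′! (λ a∈ b∈ → one ¬hz (C′⊆A a∈) (C′⊆A b∈)))))))
        k≤∣D∣ : k ≤ length D
        -- At least `2k + 1 - 3 = 2k - 2` elements remain, which is at least `k` because `k ≥ 2`.
        k≤∣D∣ = ℕ.+-cancelˡ-≤ 2 _ _ (ℕ.≤-trans (ℕ.+-monoˡ-≤ k 2≤k)
          (subst (_≤ 2 + length D) (cong (k +_) (ℕ.+-identityʳ k)) (ℕ.≤-pred 2k<3+∣D∣)))

-- Walks, routes and detours.

module _ {V : Set} (G : Graph V) where

  data Walk : V → V → List V → Set where
    stop : ∀ {x} → Walk x x (x ∷ [])
    _∷_  : ∀ {x y z xs} → Adj G x y → Walk y z xs → Walk x z (x ∷ xs)

  -- Only the multiset of the vertices is recorded, so reversing a route does not change its index.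
  Route : V → V → List V → Set
  Route x y xs = ∃[ ys ] Walk x y ys × ys ↭ xs

  -- The ends `x` and `y` are not counted in the index, so splicing a detour into a route adds
  -- exactly `xs` to its vertices.
  Detour : V → V → List V → Set
  Detour x y xs = ∃[ x′ ] ∃[ y′ ] Adj G x x′ × Route x′ y′ xs × Adj G y′ y

module _ {V : Set} {G : Graph V} where

  walk-++ : ∀ {x y z w xs ys} → Walk G x y xs → Adj G y z → Walk G z w ys → Walk G x w (xs ++ ys)
  walk-++ stop    a q = a ∷ q
  walk-++ (b ∷ p) a q = b ∷ walk-++ p a q

  walk-reverse : ∀ {x y xs} → Walk G x y xs → Walk G y x (reverse xs)
  walk-reverse stop = stop
  walk-reverse {x} {y} (_∷_ {xs = xs} a p) =
    subst (Walk G y x) (sym (List.unfold-reverse x xs)) (walk-++ (walk-reverse p) (adj-sym G a) stop)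

  infixr 5 _—⟨_⟩_ _—⟪_⟫_

  _—⟨_⟩_ : ∀ {x y z w xs ys} → Route G x y xs → Adj G y z → Route G z w ys → Route G x w (xs ++ ys)
  (_ , p , e) —⟨ a ⟩ (_ , q , f) = _ , walk-++ p a q , ++⁺ e f

  _—⟪_⟫_ : ∀ {x y z w xs hs ys} → Route G x y xs → Detour G y z hs → Route G z w ys → Route G x w (xs ++ hs ++ ys)
  p —⟪ _ , _ , a , h , b ⟫ q = p —⟨ a ⟩ h —⟨ b ⟩ q

  back : ∀ {x y xs} → Route G x y xs → Route G y x xs
  back (ys , p , e) = reverse ys , walk-reverse p , ↭-trans (↭-reverse ys) e

  detour-back : ∀ {x y hs} → Detour G x y hs → Detour G y x hs
  detour-back (_ , _ , a , h , b) = _ , _ , adj-sym G b , back h , adj-sym G a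

  route-↭ : ∀ {x y xs ys} → xs ↭ ys → Route G x y xs → Route G x y ys
  route-↭ e (_ , p , f) = _ , p , ↭-trans f e

  route-[] : ∀ x → Route G x x (x ∷ [])
  route-[] x = (x ∷ []) , stop , ↭-refl

-- Segments of an indexed path.

run : {V : Set} → (ℕ → V) → ℕ → ℕ → List V
run p lo zero    = []
run p lo (suc d) = p lo ∷ run p (suc lo) d

run-++ : {V : Set} (p : ℕ → V) → ∀ lo d e → run p lo (d + e) ≡ run p lo d ++ run p (lo + d) e
run-++ p lo zero    e = cong (λ t → run p t e) (sym (ℕ.+-identityʳ lo))
run-++ p lo (suc d) e = cong (p lo ∷_) (trans (run-++ p (suc lo) d e)
  (cong (λ t → run p (suc lo) d ++ run p t e) (sym (ℕ.+-suc lo d))))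

-- Both ends are included. For `hi < lo` truncated subtraction still leaves `p lo`, hence the order
-- hypotheses when an interval is split.
interval : {V : Set} → (ℕ → V) → ℕ → ℕ → List V
interval p lo hi = run p lo (suc (hi ∸ lo))

interval-++ : {V : Set} (p : ℕ → V) → ∀ {lo mid hi} → lo ≤ mid → mid < hi →
  interval p lo hi ≡ interval p lo mid ++ interval p (suc mid) hi
interval-++ p {lo} {mid} {hi} lo≤mid mid<hi = begin
  run p lo (suc (hi ∸ lo))                             ≡⟨ cong (run p lo) eq ⟩
  run p lo (suc (mid ∸ lo) + suc (hi ∸ suc mid))       ≡⟨ run-++ p lo (suc (mid ∸ lo)) _ ⟩
  interval p lo mid ++ run p (lo + suc (mid ∸ lo)) (suc (hi ∸ suc mid))
    ≡⟨ cong (λ t → interval p lo mid ++ run p t (suc (hi ∸ suc mid))) (trans (ℕ.+-suc lo _) (cong suc (ℕ.m+[n∸m]≡n lo≤mid))) ⟩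
  interval p lo mid ++ interval p (suc mid) hi ∎
  where
  open ≡-Reasoning
  eq : suc (hi ∸ lo) ≡ suc (mid ∸ lo) + suc (hi ∸ suc mid)
  eq = cong suc (sym (begin
    (mid ∸ lo) + suc (hi ∸ suc mid) ≡⟨ cong ((mid ∸ lo) +_) (sym (ℕ.+-∸-assoc 1 mid<hi)) ⟩
    (mid ∸ lo) + (hi ∸ mid)         ≡⟨ ℕ.+-comm (mid ∸ lo) _ ⟩
    (hi ∸ mid) + (mid ∸ lo)         ≡⟨ sym (ℕ.+-∸-assoc (hi ∸ mid) lo≤mid) ⟩
    ((hi ∸ mid) + mid) ∸ lo         ≡⟨ cong (_∸ lo) (ℕ.m∸n+n≡m (ℕ.<⇒≤ mid<hi)) ⟩
    hi ∸ lo ∎))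

-- Rerouting a path through a detour.

module _ {V : Set} (G : Graph V) (p : ℕ → V) (L : ℕ) (step : ∀ {t} → t < L → Adj G (p t) (p (suc t))) where

  private
    ⟦_,_⟧ = interval p

    run-walk : ∀ lo d → d + lo ≤ L → Walk G (p lo) (p (d + lo)) (run p lo (suc d))
    run-walk lo zero    _  = stop
    run-walk lo (suc d) le = step (ℕ.≤-trans (s≤s (ℕ.m≤n+m lo d)) le) ∷
      subst (λ t → Walk G (p (suc lo)) (p t) (run p (suc lo) (suc d))) (ℕ.+-suc d lo)
        (run-walk (suc lo) d (subst (_≤ L) (sym (ℕ.+-suc d lo)) le))

  along : ∀ {lo hi} → lo ≤ hi → hi ≤ L → Route G (p lo) (p hi) ⟦ lo , hi ⟧
  along {lo} {hi} lo≤hi hi≤L = _ , subst (λ t → Walk G (p lo) (p t) ⟦ lo , hi ⟧) (ℕ.m∸n+n≡m lo≤hi)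
    (run-walk lo (hi ∸ lo) (subst (_≤ L) (sym (ℕ.m∸n+n≡m lo≤hi)) hi≤L)) , ↭-refl

  open CMSolver (++-commutativeMonoid {A = V}) using (solve; _⊜_; _⊕_)

  insert-detour : ∀ {i hs} → i < L → Detour G (p i) (p (suc i)) hs → Route G (p 0) (p L) (⟦ 0 , L ⟧ ++ hs)
  insert-detour {i} {hs} i<L h = subst (λ xs → Route G (p 0) (p L) (xs ++ hs)) (sym (interval-++ p z≤n i<L))
    (route-↭ (solve 3 (λ a b h → (a ⊕ h ⊕ b) ⊜ ((a ⊕ b) ⊕ h)) ↭-refl ⟦ 0 , i ⟧ ⟦ suc i , L ⟧ hs)
      (along z≤n (ℕ.<⇒≤ i<L) —⟪ h ⟫ along i<L ℕ.≤-refl))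

  -- The route runs from `p 0` to `p i`, takes the detour to `p j`, returns down to `p (i + 1)`, and
  -- `join` carries it over to `p (j + 1)` and on to `p L`. In the uses `gs` is empty (an edge) or
  -- one off-path vertex.
  swap-tails : ∀ {i j hs gs} → i < j → j < L → Detour G (p i) (p j) hs →
    (∀ {xs ys} → Route G (p 0) (p (suc i)) xs → Route G (p (suc j)) (p L) ys → Route G (p 0) (p L) (xs ++ gs ++ ys)) →
    Route G (p 0) (p L) (⟦ 0 , L ⟧ ++ gs ++ hs)
  swap-tails {i} {j} {hs} {gs} i<j j<L h join =
    subst (λ xs → Route G (p 0) (p L) (xs ++ gs ++ hs))
      (sym (trans (interval-++ p z≤n (ℕ.<-trans i<j j<L)) (cong (⟦ 0 , i ⟧ ++_) (interval-++ p i<j j<L))))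
      (route-↭ (solve 5 (λ a b c g h → ((a ⊕ h ⊕ b) ⊕ g ⊕ c) ⊜ ((a ⊕ b ⊕ c) ⊕ g ⊕ h)) ↭-refl
          ⟦ 0 , i ⟧ ⟦ suc i , j ⟧ ⟦ suc j , L ⟧ gs hs)
        (join (along z≤n (ℕ.<⇒≤ (ℕ.<-trans i<j j<L)) —⟪ h ⟫ back (along i<j (ℕ.<⇒≤ j<L))) (along j<L ℕ.≤-refl)))

  -- The route jumps from `p 0` to `p (i + 1)`, climbs to `p j`, takes the detour to `p i`, descends
  -- to `p 1`, jumps to `p (j + 1)` and climbs to `p L`. It serves hubs at `p 0` and `p 1`, out of
  -- reach of `crossing` since `p 0` has no predecessor.
  start-crossing : ∀ {i j hs} → 0 < i → i < j → j < L → Detour G (p i) (p j) hs →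
    Adj G (p 0) (p (suc i)) → Adj G (p 1) (p (suc j)) → Route G (p 0) (p L) (⟦ 0 , L ⟧ ++ hs)
  start-crossing {i} {j} {hs} 0<i i<j j<L h e f =
    subst (λ xs → Route G (p 0) (p L) (xs ++ hs)) (sym eq)
      (route-↭ (solve 5 (λ a b c d h → (a ⊕ c ⊕ h ⊕ b ⊕ d) ⊜ ((a ⊕ b ⊕ c ⊕ d) ⊕ h)) ↭-refl
          ⟦ 0 , 0 ⟧ ⟦ 1 , i ⟧ ⟦ suc i , j ⟧ ⟦ suc j , L ⟧ hs)
        (along z≤n z≤n —⟨ e ⟩ along i<j j≤L —⟪ detour-back h ⟫ back (along 0<i (ℕ.≤-trans (ℕ.<⇒≤ i<j) j≤L))
          —⟨ f ⟩ along j<L ℕ.≤-refl))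
    where
    j≤L = ℕ.<⇒≤ j<L
    eq : ⟦ 0 , L ⟧ ≡ ⟦ 0 , 0 ⟧ ++ ⟦ 1 , i ⟧ ++ ⟦ suc i , j ⟧ ++ ⟦ suc j , L ⟧
    eq = trans (interval-++ p z≤n (ℕ.<-≤-trans (ℕ.<-trans 0<i i<j) j≤L)) (cong (⟦ 0 , 0 ⟧ ++_)
        (trans (interval-++ p 0<i (ℕ.<-trans i<j j<L)) (cong (⟦ 1 , i ⟧ ++_) (interval-++ p i<j j<L))))

  private
    -- Four cuts leave five segments. Since a route records only the multiset of its vertices,
    -- `reassemble` accepts the segments in any order.
    module Cut {q₁ q₂ q₃ q₄} (lt₁ : q₁ < q₂) (lt₂ : q₂ < q₃) (lt₃ : q₃ < q₄) (lt₄ : q₄ < L) where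
      le₄ = ℕ.<⇒≤ lt₄
      le₃ = ℕ.≤-trans (ℕ.<⇒≤ lt₃) le₄
      le₂ = ℕ.≤-trans (ℕ.<⇒≤ lt₂) le₃
      i₁ = ⟦ 0 , q₁ ⟧
      i₂ = ⟦ suc q₁ , q₂ ⟧
      i₃ = ⟦ suc q₂ , q₃ ⟧
      i₄ = ⟦ suc q₃ , q₄ ⟧
      i₅ = ⟦ suc q₄ , L ⟧
      r₁ = along {0} {q₁} z≤n (ℕ.≤-trans (ℕ.<⇒≤ lt₁) le₂)
      r₂ = along lt₁ le₂
      r₃ = along lt₂ le₃
      r₄ = along lt₃ le₄
      r₅ = along lt₄ ℕ.≤-refl
      reassemble : ∀ {x y xs hs} → xs ↭ (i₁ ++ i₂ ++ i₃ ++ i₄ ++ i₅) ++ hs → Route G x y xs →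
        Route G x y (⟦ 0 , L ⟧ ++ hs)
      reassemble {hs = hs} e r = route-↭ (↭-trans e (↭-reflexive (cong (_++ hs) (sym eq)))) r
        where
        eq : ⟦ 0 , L ⟧ ≡ i₁ ++ i₂ ++ i₃ ++ i₄ ++ i₅
        eq = trans (interval-++ p z≤n (ℕ.<-≤-trans lt₁ le₂)) (cong (i₁ ++_)
          (trans (interval-++ p lt₁ (ℕ.<-≤-trans lt₂ le₃)) (cong (i₂ ++_)
          (trans (interval-++ p lt₂ (ℕ.<-≤-trans lt₃ le₄)) (cong (i₃ ++_) (interval-++ p lt₃ lt₄))))))

  -- An edge between successors forbids equal positions, so `b`, `c`, `i`, `j` are distinct and
  -- occur in one of six orders. In each, the first and last of the five segments stay in place, and
  -- the four links are the edge `bc`, the detour and two of the edges given by `adj`.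
  crossing : ∀ {b c i j hs} → b < c → c < L → Adj G (p b) (p c) → i < j → j < L → Detour G (p i) (p j) hs →
    (∀ {s t} → s ≡ b ⊎ s ≡ c → t ≡ i ⊎ t ≡ j → Adj G (p (suc s)) (p (suc t))) →
    Route G (p 0) (p L) (⟦ 0 , L ⟧ ++ hs)
  crossing {b} {c} {i} {j} {hs} b<c c<L bc i<j j<L h adj = go
    where
    cb = adj-sym G bc
    -- These edges join successors: `bi` joins `p (b + 1)` to `p (i + 1)`, whereas `bc` joins `p b`
    -- to `p c`.
    bi = adj (inj₁ refl) (inj₁ refl)
    bj = adj (inj₁ refl) (inj₂ refl)
    ci = adj (inj₂ refl) (inj₁ refl)
    cj = adj (inj₂ refl) (inj₂ refl)
    ib = adj-sym G bi
    jb = adj-sym G bj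
    ic = adj-sym G ci
    jc = adj-sym G cj
    distinct : ∀ {s t} → Adj G (p (suc s)) (p (suc t)) → t ≢ s
    distinct a refl = no-loop G a

    i<j<b<c : j < b → Route G (p 0) (p L) (⟦ 0 , L ⟧ ++ hs)
    i<j<b<c j<b = reassemble
      (solve 6 (λ x₁ x₂ x₃ x₄ x₅ h → (x₁ ⊕ h ⊕ x₂ ⊕ x₄ ⊕ x₃ ⊕ x₅) ⊜ ((x₁ ⊕ x₂ ⊕ x₃ ⊕ x₄ ⊕ x₅) ⊕ h))
        ↭-refl i₁ i₂ i₃ i₄ i₅ hs)
      (r₁ —⟪ h ⟫ back r₂ —⟨ ib ⟩ r₄ —⟨ cb ⟩ back r₃ —⟨ jc ⟩ r₅)
      where open Cut i<j j<b b<c c<L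

    b<i<j<c : b < i → j < c → Route G (p 0) (p L) (⟦ 0 , L ⟧ ++ hs)
    b<i<j<c b<i j<c = reassemble
      (solve 6 (λ x₁ x₂ x₃ x₄ x₅ h → (x₁ ⊕ x₄ ⊕ x₂ ⊕ h ⊕ x₃ ⊕ x₅) ⊜ ((x₁ ⊕ x₂ ⊕ x₃ ⊕ x₄ ⊕ x₅) ⊕ h))
        ↭-refl i₁ i₂ i₃ i₄ i₅ hs)
      (r₁ —⟨ bc ⟩ back r₄ —⟨ jb ⟩ r₂ —⟪ h ⟫ back r₃ —⟨ ic ⟩ r₅)
      where open Cut b<i i<j j<c c<L

    b<c<i<j : c < i → Route G (p 0) (p L) (⟦ 0 , L ⟧ ++ hs)
    b<c<i<j c<i = reassemble
      (solve 6 (λ x₁ x₂ x₃ x₄ x₅ h → (x₁ ⊕ x₂ ⊕ x₄ ⊕ h ⊕ x₃ ⊕ x₅) ⊜ ((x₁ ⊕ x₂ ⊕ x₃ ⊕ x₄ ⊕ x₅) ⊕ h))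
        ↭-refl i₁ i₂ i₃ i₄ i₅ hs)
      (r₁ —⟨ bc ⟩ back r₂ —⟨ bi ⟩ r₄ —⟪ detour-back h ⟫ back r₃ —⟨ cj ⟩ r₅)
      where open Cut b<c c<i i<j j<L

    i<b<j<c : i < b → b < j → j < c → Route G (p 0) (p L) (⟦ 0 , L ⟧ ++ hs)
    i<b<j<c i<b b<j j<c = reassemble
      (solve 6 (λ x₁ x₂ x₃ x₄ x₅ h → (x₁ ⊕ h ⊕ x₃ ⊕ x₂ ⊕ x₄ ⊕ x₅) ⊜ ((x₁ ⊕ x₂ ⊕ x₃ ⊕ x₄ ⊕ x₅) ⊕ h))
        ↭-refl i₁ i₂ i₃ i₄ i₅ hs)
      (r₁ —⟪ h ⟫ back r₃ —⟨ bi ⟩ r₂ —⟨ bc ⟩ back r₄ —⟨ jc ⟩ r₅)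
      where open Cut i<b b<j j<c c<L

    i<b<c<j : i < b → c < j → Route G (p 0) (p L) (⟦ 0 , L ⟧ ++ hs)
    i<b<c<j i<b c<j = reassemble
      (solve 6 (λ x₁ x₂ x₃ x₄ x₅ h → (x₁ ⊕ h ⊕ x₄ ⊕ x₂ ⊕ x₃ ⊕ x₅) ⊜ ((x₁ ⊕ x₂ ⊕ x₃ ⊕ x₄ ⊕ x₅) ⊕ h))
        ↭-refl i₁ i₂ i₃ i₄ i₅ hs)
      (r₁ —⟪ h ⟫ back r₄ —⟨ ci ⟩ r₂ —⟨ bc ⟩ back r₃ —⟨ bj ⟩ r₅)
      where open Cut i<b b<c c<j j<L

    b<i<c<j : b < i → i < c → c < j → Route G (p 0) (p L) (⟦ 0 , L ⟧ ++ hs)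
    b<i<c<j b<i i<c c<j = reassemble
      (solve 6 (λ x₁ x₂ x₃ x₄ x₅ h → (x₁ ⊕ x₃ ⊕ x₂ ⊕ h ⊕ x₄ ⊕ x₅) ⊜ ((x₁ ⊕ x₂ ⊕ x₃ ⊕ x₄ ⊕ x₅) ⊕ h))
        ↭-refl i₁ i₂ i₃ i₄ i₅ hs)
      (r₁ —⟨ bc ⟩ back r₃ —⟨ ib ⟩ r₂ —⟪ h ⟫ back r₄ —⟨ cj ⟩ r₅)
      where open Cut b<i i<c c<j j<L

    go : Route G (p 0) (p L) (⟦ 0 , L ⟧ ++ hs)
    go with ℕ.<-cmp i b | ℕ.<-cmp i c | ℕ.<-cmp j b | ℕ.<-cmp j c
    ... | tri≈ _ e _   | _            | _            | _            = contradiction e (distinct bi)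
    ... | _            | tri≈ _ e _   | _            | _            = contradiction e (distinct ci)
    ... | _            | _            | tri≈ _ e _   | _            = contradiction e (distinct bj)
    ... | _            | _            | _            | tri≈ _ e _   = contradiction e (distinct cj)
    ... | tri> _ _ _   | tri> _ _ c<i | _            | _            = b<c<i<j c<i
    ... | tri> _ _ b<i | tri< i<c _ _ | _            | tri< j<c _ _ = b<i<j<c b<i j<c
    ... | tri> _ _ b<i | tri< i<c _ _ | _            | tri> _ _ c<j = b<i<c<j b<i i<c c<j
    ... | tri< i<b _ _ | _            | tri< j<b _ _ | _            = i<j<b<c j<b
    ... | tri< i<b _ _ | _            | tri> _ _ b<j | tri< j<c _ _ = i<b<j<c i<b b<j j<c
    ... | tri< i<b _ _ | _            | tri> _ _ _   | tri> _ _ c<j = i<b<c<j i<b c<j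

-- Lists and walks indexed by position.

unique-map : {B : Set} (f : A → B) {xs : List A} → (∀ {x y} → x ∈ˡ xs → y ∈ˡ xs → f x ≡ f y → x ≡ y) →
  Unique xs → Unique (map f xs)
unique-map f inj []        = []
unique-map f {x ∷ xs} inj (x∉ ∷ u) =
  All.tabulate (λ fy∈ → λ { refl → let y , y∈ , e = ∈-map⁻ f fy∈ in
    All.lookup x∉ y∈ (inj (here refl) (there y∈) e) })
  ∷ unique-map f (λ x∈ y∈ → inj (there x∈) (there y∈)) u

unique-second : {x : A} {xs : List A} → Unique (x ∷ xs) → 2 ≤ length (x ∷ xs) → ∃[ y ] y ∈ˡ x ∷ xs × x ≢ y
unique-second {xs = []}    _               (s≤s ())
unique-second {xs = y ∷ _} ((x≢y ∷ _) ∷ _) _ = y , there (here refl) , x≢y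

-- A union bound: an entry that is lost fails `P` or `Q`. It yields common neighbours of two hubs.
length-filter-×≥ : {P Q : Pred A 0ℓ} (P? : Decidable P) (Q? : Decidable Q) → ∀ xs →
  length xs ≤ length (filter Q? (filter P? xs)) + (length (filter (¬? ∘ P?) xs) + length (filter (¬? ∘ Q?) xs))
length-filter-×≥ P? Q? [] = z≤n
length-filter-×≥ P? Q? (x ∷ xs) with ih ← length-filter-×≥ P? Q? xs | P? x
length-filter-×≥ P? Q? (x ∷ xs) | true because _ with Q? x
... | true  because _ = s≤s ih
... | false because _ = ℕ.≤-trans (s≤s ih) (ℕ.≤-reflexive (sym (trans (cong (m +_) (ℕ.+-suc p _)) (ℕ.+-suc m _))))
  where m = length (filter Q? (filter P? xs)) ; p = length (filter (¬? ∘ P?) xs)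
length-filter-×≥ P? Q? (x ∷ xs) | false because _ with Q? x
... | true  because _ = ℕ.≤-trans (s≤s ih) (ℕ.≤-reflexive (sym (ℕ.+-suc (length (filter Q? (filter P? xs))) _)))
... | false because _ = ℕ.≤-trans (s≤s ih) (ℕ.≤-trans (ℕ.≤-reflexive (sym (ℕ.+-suc m _)))
    (ℕ.+-monoʳ-≤ m (s≤s (ℕ.+-monoʳ-≤ p (ℕ.n≤1+n _)))))
  where m = length (filter Q? (filter P? xs)) ; p = length (filter (¬? ∘ P?) xs)

-- d is a junk value beyond the end of the list.
at : A → List A → ℕ → A
at d []       _       = d
at d (x ∷ xs) zero    = x
at d (x ∷ xs) (suc t) = at d xs t

module _ (d : A) where

  at-∈ : ∀ {xs t} → t < length xs → at d xs t ∈ˡ xs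
  at-∈ {_ ∷ _} {zero}  _       = here refl
  at-∈ {_ ∷ _} {suc t} (s≤s l) = there (at-∈ l)

  ∈-at : ∀ {xs x} → x ∈ˡ xs → ∃[ t ] t < length xs × at d xs t ≡ x
  ∈-at (here refl) = 0 , s≤s z≤n , refl
  ∈-at (there x∈) with t , l , e ← ∈-at x∈ = suc t , s≤s l , e

  at-injective : ∀ {xs} → Unique xs → ∀ {s t} → s < length xs → t < length xs → at d xs s ≡ at d xs t → s ≡ t
  at-injective {_ ∷ _} _        {zero}  {zero}  _       _       _ = refl
  at-injective {_ ∷ _} (x∉ ∷ _) {zero}  {suc t} _       (s≤s l) e = contradiction e (All.lookup x∉ (at-∈ l))
  at-injective {_ ∷ _} (x∉ ∷ _) {suc s} {zero}  (s≤s l) _       e = contradiction (sym e) (All.lookup x∉ (at-∈ l))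
  at-injective {_ ∷ _} (_ ∷ u)  {suc s} {suc t} (s≤s l) (s≤s m) e = cong suc (at-injective u l m e)

  run-at-∷ : ∀ x xs lo m → run (at d (x ∷ xs)) (suc lo) m ≡ run (at d xs) lo m
  run-at-∷ x xs lo zero    = refl
  run-at-∷ x xs lo (suc m) = cong (at d xs lo ∷_) (run-at-∷ x xs (suc lo) m)

  run-at : ∀ xs → run (at d xs) 0 (length xs) ≡ xs
  run-at []       = refl
  run-at (x ∷ xs) = cong (x ∷_) (trans (run-at-∷ x xs 0 (length xs)) (run-at xs))

module _ {G : Graph V} where

  walk-at-0 : ∀ {x y xs} d → Walk G x y xs → at d xs 0 ≡ x
  walk-at-0 d stop    = refl
  walk-at-0 d (_ ∷ _) = refl

  walk-at-last : ∀ {x y xs} d → Walk G x y xs → ∃[ L ] length xs ≡ suc L × at d xs L ≡ y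
  walk-at-last d stop    = 0 , refl , refl
  walk-at-last d (_ ∷ w) with L , l , e ← walk-at-last d w = suc L , cong suc l , e

  walk-at-step : ∀ {x y xs t} d → Walk G x y xs → suc t < length xs → Adj G (at d xs t) (at d xs (suc t))
  walk-at-step           d stop    (s≤s ())
  walk-at-step {t = zero}  d (a ∷ w) _       = subst (Adj G _) (sym (walk-at-0 d w)) a
  walk-at-step {t = suc t} d (_ ∷ w) (s≤s l) = walk-at-step d w l

  walk-head : ∀ {x y xs} → Walk G x y xs → head xs ≡ just x
  walk-head stop    = refl
  walk-head (_ ∷ _) = refl

  walk-last : ∀ {x y xs} → Walk G x y xs → last xs ≡ just y
  walk-last stop               = refl
  walk-last (_ ∷ stop)         = refl
  walk-last (_ ∷ w@(_ ∷ _))    = walk-last w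

  walk-linked : ∀ {x y xs} → Walk G x y xs → Linked (Adj G) xs
  walk-linked stop            = [-]
  walk-linked (a ∷ stop)      = a ∷ [-]
  walk-linked (a ∷ w@(_ ∷ _)) = a ∷ walk-linked w

  walk-nonempty : ∀ {x y xs} → Walk G x y xs → 0 < length xs
  walk-nonempty stop    = s≤s z≤n
  walk-nonempty (_ ∷ _) = s≤s z≤n

  walk-suffix : ∀ {x y z xs} → Walk G y z xs → Unique xs → x ∈ˡ xs →
    ∃[ ys ] Walk G x z ys × Unique ys × (∀ {w} → w ∈ˡ ys → w ∈ˡ xs)
  walk-suffix stop    u       (here refl) = _ , stop , u , id
  walk-suffix (a ∷ w) u       (here refl) = _ , a ∷ w , u , id
  walk-suffix (_ ∷ w) (_ ∷ u) (there x∈) with _ , w′ , u′ , sub ← walk-suffix w u x∈ = _ , w′ , u′ , there ∘ sub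

-- Loop erasure and cuts.

-- If `x` recurs, the walk is replaced by its suffix from `x`. Remembering that each vertex reaches
-- `y` through `R` shows later that a detour stays inside the off-path component.
erase-loops : (G : Graph (Fin n)) {R : Rel (Fin n) 0ℓ} → (∀ {x y} → R x y → Adj G x y) → ∀ {x y} → Star R x y →
  ∃[ xs ] Walk G x y xs × Unique xs × (∀ {z} → z ∈ˡ xs → Star R z y)
erase-loops G R⇒Adj ε = _ , stop , [] ∷ [] , λ { (here refl) → ε }
erase-loops G R⇒Adj {x} (a ◅ r) with xs , w , u , reach ← erase-loops G R⇒Adj r with _∈ˡ?_ Fin._≟_ x xs
... | yes x∈ with ys , w′ , u′ , sub ← walk-suffix w u x∈ = ys , w′ , u′ , reach ∘ sub
... | no  x∉ = x ∷ xs , R⇒Adj a ∷ w , All.tabulate (λ y∈ → λ { refl → x∉ y∈ }) ∷ u ,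
  λ { (here refl) → a ◅ r ; (there z∈) → reach z∈ }

connected⇒≤cut : (G : Graph (Fin n)) → ∀ {m} → IsConnected m G → ∀ S → Disconnected (G - S) → m ≤ ∣ S ∣
connected⇒≤cut G (_ , (_ , minimal) , m≤κ) S disconnected = ℕ.≤-trans m≤κ (minimal _ (S , refl , inj₁ disconnected))

-- A maximal path that misses a vertex.

module _ (G : Graph (Fin n)) (2≤k : 2 ≤ k)
  (connected : IsConnected (2 * k + 1) G)
  (free : G isFreeOf (path 3 ∪ᵍ copies k (path 1)))
  (tough : ToughnessGreaterThan 1ℚ G)
  (p : ℕ → Fin n) (L : ℕ) (0<L : 0 < L)
  (step : ∀ {t} → t < L → Adj G (p t) (p (suc t)))
  (p-injective : ∀ {s t} → s ≤ L → t ≤ L → p s ≡ p t → s ≡ t)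
  where

  Off : Pred (Fin n) 0ℓ
  Off x = ∀ t → t ≤ L → p t ≢ x

  module _ (on-or-off : ∀ x → (∃[ t ] t ≤ L × p t ≡ x) ⊎ Off x)
    -- Maximality in the form used: no route with the same ends absorbs a nonempty set of distinct
    -- off-path vertices.
    (maximal : ∀ {hs} → Route G (p 0) (p L) (interval p 0 L ++ hs) → Unique hs →
      (∀ {x} → x ∈ˡ hs → Off x) → ¬ 0 < length hs)
    (h : Fin n) (h-off : Off h) where

    private
      _~_ = Adj G

      R : Rel (Fin n) 0ℓ
      R x y = x ~ y × Off x × Off y

      H : Pred (Fin n) 0ℓ
      H x = Star R x h

      H-off : ∀ {x} → H x → Off x
      H-off ε = h-off
      H-off ((_ , x-off , _) ◅ _) = x-off

      Attached : Pred (Fin n) 0ℓ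
      Attached v = ∃[ x ] H x × v ~ x

      -- The walk goes from `x` through `h` to `y` inside the component; loops are erased because
      -- `maximal` wants distinct vertices.
      detour : ∀ {v w} → Attached v → Attached w →
        ∃[ hs ] Detour G v w hs × Unique hs × (∀ {x} → x ∈ˡ hs → H x) × 0 < length hs
      detour (x , Hx , vx) (y , Hy , wy)
        with hs , w , u , reach ← erase-loops G proj₁ (Hx ◅◅ Star.reverse (λ (a , o , o′) → adj-sym G a , o′ , o) Hy) =
        hs , (x , y , vx , (hs , w , _↭_.refl) , adj-sym G wy) , u , (λ z∈ → reach z∈ ◅◅ Hy) , walk-nonempty w

      ¬consecutive : ∀ {t} → t < L → Attached (p t) → ¬ Attached (p (suc t))
      ¬consecutive t<L at at′ with hs , d , u , inH , ne ← detour at at′ =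
        maximal (insert-detour G p L step t<L d) u (H-off ∘ inH) ne

      -- The edge between the successors is the crossing edge of `swap-tails`.
      successors-independent< : ∀ {i j} → i < j → j < L → Attached (p i) → Attached (p j) → ¬ p (suc i) ~ p (suc j)
      successors-independent< i<j j<L ai aj e with hs , d , u , inH , ne ← detour ai aj =
        maximal (swap-tails G p L step {gs = []} i<j j<L d (λ q r → q —⟨ e ⟩ r)) u (H-off ∘ inH) ne

      successors-independent : ∀ {i j} → i < L → j < L → Attached (p i) → Attached (p j) → ¬ p (suc i) ~ p (suc j)
      successors-independent {i} {j} i<L j<L ai aj e with ℕ.<-cmp i j
      ... | tri< i<j _ _ = successors-independent< i<j j<L ai aj e
      ... | tri≈ _ refl _ = no-loop G e
      ... | tri> _ _ j<i = successors-independent< j<i i<L aj ai (adj-sym G e)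

      -- `swap-tails` crosses over through `s`; as `s` is not in `H`, it is distinct from the detour
      -- vertices.
      no-common-off-neighbour< : ∀ {i j s} → i < j → j < L → Attached (p i) → Attached (p j) → Off s → ¬ H s →
        s ~ p (suc i) → ¬ s ~ p (suc j)
      no-common-off-neighbour< {s = s} i<j j<L ai aj s-off ¬Hs si sj with hs , d , u , inH , ne ← detour ai aj =
        maximal (swap-tails G p L step {gs = s ∷ []} i<j j<L d (λ q r → q —⟨ adj-sym G si ⟩ route-[] s —⟨ sj ⟩ r))
          (All.tabulate (λ y∈ → λ { refl → ¬Hs (inH y∈) }) ∷ u)
          (λ { (here refl) → s-off ; (there y∈) → H-off (inH y∈) }) (s≤s z≤n)

      no-common-off-neighbour : ∀ {i j s} → i ≢ j → i < L → j < L → Attached (p i) → Attached (p j) → Off s → ¬ H s →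
        s ~ p (suc i) → ¬ s ~ p (suc j)
      no-common-off-neighbour {i} {j} i≢j i<L j<L ai aj o ¬Hs si sj with ℕ.<-cmp i j
      ... | tri< i<j _ _ = no-common-off-neighbour< i<j j<L ai aj o ¬Hs si sj
      ... | tri≈ _ i≡j _ = i≢j i≡j
      ... | tri> _ _ j<i = no-common-off-neighbour< j<i i<L aj ai o ¬Hs sj si

      -- The attached path vertices separate `h` from the rest of the path, so there are at least
      -- `2k + 1` of them. Position `L`, which has no successor, costs at most one.
      attached-positions : ¬ ¬ (∃[ I ] Unique I × (∀ {t} → t ∈ˡ I → t < L × Attached (p t)) × 2 * k ≤ length I)
      attached-positions ¬I = ¬¬-decidable N λ N? → ¬I (positions N?)
        where
        N : Pred (Fin n) 0ℓ
        N v = Attached v × ∃[ t ] t ≤ L × p t ≡ v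
        positions : Decidable N → ∃[ I ] Unique I × (∀ {t} → t ∈ˡ I → t < L × Attached (p t)) × 2 * k ≤ length I
        positions N? = I , Unique.filter⁺ _ J! , I-spec , ℕ.≤-pred (ℕ.≤-trans 1+2k≤∣J∣ (discard-one (ℕ._≟ L) J! λ { _ _ refl refl → refl }))
          where
          T : Subset n
          T = comprehension N?
          N-elements : ∀ i → N (elements T i)
          N-elements i = ∈-comprehension⁻ N? (elements-∈ T i)
          pos : Fin ∣ T ∣ → ℕ
          pos i = proj₁ (proj₂ (N-elements i))
          pos-injective : Injective _≡_ _≡_ pos
          pos-injective {i} {j} e = elements-injective T
            (trans (sym (proj₂ (proj₂ (proj₂ (N-elements i))))) (trans (cong p e) (proj₂ (proj₂ (proj₂ (N-elements j))))))
          J : List ℕ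
          J = map pos (allFin ∣ T ∣)
          J! : Unique J
          J! = Unique.map⁺ pos-injective (Unique.allFin⁺ ∣ T ∣)
          I : List ℕ
          I = filter (λ t → ¬? (t ℕ.≟ L)) J
          I-spec : ∀ {t} → t ∈ˡ I → t < L × Attached (p t)
          I-spec t∈ with t∈J , t≢L ← ∈-filter⁻ (λ t → ¬? (t ℕ.≟ L)) {xs = J} t∈ with i , _ , refl ← ∈-map⁻ pos t∈J
            with a , t , t≤L , e ← N-elements i = ℕ.≤∧≢⇒< t≤L t≢L , subst Attached (sym e) a
          -- A walk in `G - T` cannot leave `H`: its first vertex on the path would be attached,
          -- hence in `T`.
          closed : ∀ {x y} → H (proj₁ x) → Reachable (G - T) x y → H (proj₁ y)
          closed Hx ε = Hx
          closed Hx (_◅_ {j = y} xy r) with on-or-off (proj₁ y)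
          ... | inj₁ on = contradiction (∈-comprehension⁺ N? ((_ , Hx , adj-sym G xy) , on)) (x∈∁p⇒x∉p (proj₂ y))
          ... | inj₂ y-off = closed ((adj-sym G xy , y-off , H-off Hx) ◅ Hx) r
          -- The far side of the cut must be nonempty; `p 0` and `p 1` cannot both be attached.
          unattached : ∃[ t ] t ≤ L × ¬ Attached (p t)
          unattached with N? (p 0)
          ... | yes (a , _) = 1 , 0<L , ¬consecutive 0<L a
          ... | no ¬N       = 0 , z≤n , λ a → ¬N (a , 0 , z≤n , refl)
          disconnected : Disconnected (G - T)
          disconnected with t , t≤L , ¬a ← unattached =
            (h , x∉p⇒x∈∁p (λ h∈ → let _ , t , t≤L , e = ∈-comprehension⁻ N? h∈ in h-off _ t≤L e)) ,
            (p t , x∉p⇒x∈∁p (λ pt∈ → ¬a (proj₁ (∈-comprehension⁻ N? pt∈)))) ,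
            λ r → H-off (closed ε r) _ t≤L refl
          1+2k≤∣J∣ : suc (2 * k) ≤ length J
          1+2k≤∣J∣ =
            subst₂ _≤_ (ℕ.+-comm (2 * k) 1) (sym (trans (List.length-map pos (allFin ∣ T ∣)) (List.length-tabulate id)))
              (connected⇒≤cut G connected T disconnected)

      -- The independent set and its hubs.

      module _ (I : List ℕ) (I! : Unique I) (I-spec : ∀ {t} → t ∈ˡ I → t < L × Attached (p t))
        (2k≤∣I∣ : 2 * k ≤ length I) where

        A⁺ : List (Fin n)
        A⁺ = h ∷ map (p ∘ suc) I

        A-case : ∀ {a} → a ∈ˡ A⁺ → a ≡ h ⊎ ∃[ t ] t < L × Attached (p t) × a ≡ p (suc t)
        A-case (here e) = inj₁ e
        A-case (there a∈) with t , t∈ , e ← ∈-map⁻ (p ∘ suc) a∈ with t<L , at ← I-spec t∈ = inj₂ (t , t<L , at , e)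

        A! : Unique A⁺
        A! = All.tabulate (λ a∈ → λ { refl → let t , t∈ , e = ∈-map⁻ (p ∘ suc) a∈ in h-off _ (proj₁ (I-spec t∈)) (sym e) })
          ∷ unique-map (p ∘ suc) (λ s∈ t∈ e → ℕ.suc-injective (p-injective (proj₁ (I-spec s∈)) (proj₁ (I-spec t∈)) e)) I!

        2k<∣A∣ : 2 * k < length A⁺
        2k<∣A∣ = s≤s (subst (2 * k ≤_) (sym (List.length-map (p ∘ suc) I)) 2k≤∣I∣)

        -- An edge to `h` would make two consecutive path vertices attached; an edge to another
        -- successor is excluded by rerouting.
        successor-isolated : ∀ {t} → t < L → Attached (p t) → ∀ {a} → a ∈ˡ A⁺ → ¬ p (suc t) ~ a
        successor-isolated t<L at a∈ e with A-case a∈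
        ... | inj₁ refl = ¬consecutive t<L at (h , ε , e)
        ... | inj₂ (s , s<L , as , refl) = successors-independent t<L s<L at as e

        independent : ∀ {a b} → a ∈ˡ A⁺ → b ∈ˡ A⁺ → ¬ a ~ b
        independent a∈ b∈ e with A-case a∈ | A-case b∈
        ... | inj₂ (t , t<L , at , refl) | _ = successor-isolated t<L at b∈ e
        ... | inj₁ refl | inj₂ (t , t<L , at , refl) = successor-isolated t<L at a∈ (adj-sym G e)
        ... | inj₁ refl | inj₁ refl = no-loop G e

        isHub : Pred (Fin n) 0ℓ
        isHub = Hub G A⁺

        isolated-¬hub : ∀ {v} → (∀ {a} → a ∈ˡ A⁺ → ¬ v ~ a) → ¬ isHub v
        isolated-¬hub iso hub with a , _ , a∈ , _ , _ , va , _ ← hub⁻ G A⁺ hub = iso a∈ va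

        -- If an off-path hub is adjacent to `h`, it lies in `H` and makes the successor of an
        -- attached vertex attached. Otherwise it is a common neighbour of two successors; it is
        -- again outside `H`, and the path could absorb it.
        hub-on-path : ∀ {v} → isHub v → ∃[ t ] t ≤ L × p t ≡ v
        hub-on-path {v} hub with on-or-off v
        ... | inj₁ on = on
        ... | inj₂ v-off with a , b , a∈ , b∈ , a≢b , va , vb ← hub⁻ G A⁺ hub with A-case a∈ | A-case b∈
        ...   | inj₁ refl | inj₁ refl = contradiction refl a≢b
        ...   | inj₁ refl | inj₂ (t , t<L , at , refl) =
          contradiction (_ , (va , v-off , h-off) ◅ ε , adj-sym G vb) (¬consecutive t<L at)
        ...   | inj₂ (t , t<L , at , refl) | inj₁ refl =
          contradiction (_ , (vb , v-off , h-off) ◅ ε , adj-sym G va) (¬consecutive t<L at)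
        ...   | inj₂ (s , s<L , as , refl) | inj₂ (t , t<L , at , refl) =
          contradiction vb (no-common-off-neighbour (λ { refl → a≢b refl }) s<L t<L as at v-off
            (λ Hv → ¬consecutive s<L as (_ , Hv , adj-sym G va)) va)

        -- Two hubs miss at most 2 (k - 1) elements of A⁺ in total.
        common-neighbours : ∀ {v w} → isHub v → isHub w → ∃[ i ] ∃[ j ] i < j × j < L × Attached (p i) × Attached (p j) ×
          (∀ {t} → t ≡ i ⊎ t ≡ j → v ~ p (suc t) × w ~ p (suc t))
        common-neighbours {v} {w} hv hw = extract C′ refl
          where
          C C′ : List (Fin n)
          C  = filter (adj? G w) (filter (adj? G v) A⁺)
          C! : Unique C
          C! = Unique.filter⁺ (adj? G w) (Unique.filter⁺ (adj? G v) A!)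
          C′ = filter (λ a → ¬? (a Fin.≟ h)) C
          C′! : Unique C′
          C′! = Unique.filter⁺ _ C!
          -- At least `(2k + 1) - 2 (k - 1) = 3` elements are common neighbours.
          3≤∣C∣ : 3 ≤ length C
          3≤∣C∣ = ℕ.+-cancelʳ-≤ (2 * k) _ _ (begin
            3 + 2 * k                ≤⟨ ℕ.+-monoʳ-≤ 2 2k<∣A∣ ⟩
            2 + length A⁺            ≤⟨ ℕ.+-monoʳ-≤ 2 (length-filter-×≥ (adj? G v) (adj? G w) A⁺) ⟩
            2 + (length C + (x + y)) ≡⟨ ℕ.+-comm 2 _ ⟩
            length C + (x + y) + 2   ≡⟨ ℕ.+-assoc (length C) _ 2 ⟩
            length C + (x + y + 2)   ≡⟨ cong (length C +_) (ℕ.+-comm (x + y) 2) ⟩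
            length C + (2 + (x + y)) ≡⟨ cong (λ z → length C + suc z) (sym (ℕ.+-suc x y)) ⟩
            length C + (suc x + suc y) ≤⟨ ℕ.+-monoʳ-≤ (length C) (ℕ.+-mono-≤ (nonneighbours hv) (nonneighbours hw)) ⟩
            length C + (k + k)       ≡⟨ cong (λ z → length C + (k + z)) (sym (ℕ.+-identityʳ k)) ⟩
            length C + 2 * k         ∎)
            where
            open ℕ.≤-Reasoning
            x = length (filter (¬? ∘ adj? G v) A⁺)
            y = length (filter (¬? ∘ adj? G w) A⁺)
            nonneighbours : ∀ {v} → isHub v → length (filter (¬? ∘ adj? G v) A⁺) < k
            nonneighbours = hub-nonneighbours<k G A⁺ free A! independent
          -- One of the three may be `h`; the other two are successors of attached positions.
          2≤∣C′∣ : 2 ≤ length C′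
          2≤∣C′∣ = ℕ.≤-pred (ℕ.≤-trans 3≤∣C∣ (discard-one (Fin._≟ h) C! λ { _ _ refl refl → refl }))
          C′-case : ∀ {a} → a ∈ˡ C′ → ∃[ t ] t < L × Attached (p t) × a ≡ p (suc t) × v ~ a × w ~ a
          C′-case a∈ with a∈C , a≢h ← ∈-filter⁻ (λ a → ¬? (a Fin.≟ h)) {xs = C} a∈
            with a∈B , wa ← ∈-filter⁻ (adj? G w) {xs = filter (adj? G v) A⁺} a∈C
            with a∈A , va ← ∈-filter⁻ (adj? G v) {xs = A⁺} a∈B with A-case a∈A
          ... | inj₁ a≡h = contradiction a≡h a≢h
          ... | inj₂ (t , t<L , at , e) = t , t<L , at , e , va , wa
          extract : ∀ D → D ≡ C′ → _
          extract [] e with () ← subst (2 ≤_) (cong length (sym e)) 2≤∣C′∣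
          extract (_ ∷ []) e with s≤s () ← subst (2 ≤_) (cong length (sym e)) 2≤∣C′∣
          extract (a ∷ b ∷ D) e with (a≢b ∷ _) ∷ _ ← subst Unique (sym e) C′!
            with i , i<L , ai , refl , vi , wi ← C′-case (subst (a ∈ˡ_) e (here refl))
            with j , j<L , aj , refl , vj , wj ← C′-case (subst (b ∈ˡ_) e (there (here refl)))
            with ℕ.<-cmp i j
          ... | tri< i<j _ _ = i , j , i<j , j<L , ai , aj , λ { (inj₁ refl) → vi , wi ; (inj₂ refl) → vj , wj }
          ... | tri≈ _ refl _ = contradiction refl a≢b
          ... | tri> _ _ j<i = j , i , j<i , i<L , aj , ai , λ { (inj₁ refl) → vj , wj ; (inj₂ refl) → vi , wi }

        hub-predecessors-independent : ∀ {b c} → b < c → c < L → isHub (p (suc b)) → isHub (p (suc c)) → ¬ p b ~ p c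
        hub-predecessors-independent b<c c<L hb hc bc
          with i , j , i<j , j<L , ai , aj , adj ← common-neighbours hb hc
          with hs , d , u , inH , ne ← detour ai aj =
          maximal (crossing G p L step b<c c<L bc i<j j<L d
              (λ { (inj₁ refl) t → proj₁ (adj t) ; (inj₂ refl) t → proj₂ (adj t) }))
            u (H-off ∘ inH) ne

        -- The boundary case of `hub-predecessors-independent`, settled by `start-crossing`.
        ¬first-two-hubs : isHub (p 0) → ¬ isHub (p 1)
        ¬first-two-hubs h₀ h₁
          with i , j , i<j , j<L , ai , aj , adj ← common-neighbours h₀ h₁
          with hs , d , u , inH , ne ← detour ai aj =
          -- `i = 0` would make `p 1` adjacent to itself.
          maximal (start-crossing G p L step (ℕ.n≢0⇒n>0 λ { refl → no-loop G (proj₂ (adj (inj₁ refl))) }) i<j j<L d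
              (proj₁ (adj (inj₁ refl))) (proj₂ (adj (inj₂ refl))))
            u (H-off ∘ inH) ne

        -- Predecessors of hubs and the contradiction with toughness.

        h-¬hub : ¬ isHub h
        h-¬hub = isolated-¬hub (independent (here refl))

        -- The off-path non-hub `h` at position 0 keeps one family member per hub even when `p 0` is
        -- a hub.
        previous : ℕ → Fin n
        previous zero    = h
        previous (suc t) = p t

        -- Two consecutive hubs would have consecutive, hence adjacent, predecessors; the hubs `p 0`
        -- and `p 1` need the boundary case.
        previous-¬hub : ∀ {t} → t ≤ L → isHub (p t) → ¬ isHub (previous t)
        previous-¬hub {zero}        _  _  = h-¬hub
        previous-¬hub {suc zero}    _  h₁ h₀ = ¬first-two-hubs h₀ h₁
        previous-¬hub {suc (suc t)} le h₂ h₁ =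
          hub-predecessors-independent (ℕ.n<1+n t) le h₁ h₂ (step (ℕ.<⇒≤ le))

        -- When `h` stands for the earlier predecessor, an edge from `h` to `p t` makes `p t`
        -- attached, so `p (t + 1)` has no neighbour in `A⁺` and is no hub.
        previous-apart< : ∀ {s t} → s < t → t ≤ L → isHub (p s) → isHub (p t) → Apart G (previous s) (previous t)
        previous-apart< {zero} {suc t} _ t<L _ ht =
          (λ e → h-off _ (ℕ.<⇒≤ t<L) (sym e)) ,
          (λ e → isolated-¬hub (successor-isolated t<L (h , ε , adj-sym G e)) ht)
        previous-apart< {suc s} {suc t} (s≤s s<t) t<L hs ht =
          (λ e → ℕ.<⇒≢ s<t (p-injective (ℕ.≤-trans (ℕ.<⇒≤ s<t) (ℕ.<⇒≤ t<L)) (ℕ.<⇒≤ t<L) e)) ,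
          hub-predecessors-independent s<t t<L hs ht

        previous-apart : ∀ {s t} → s ≤ L → t ≤ L → isHub (p s) → isHub (p t) → s ≢ t → Apart G (previous s) (previous t)
        previous-apart {s} {t} s≤L t≤L hs ht s≢t with ℕ.<-cmp s t
        ... | tri< s<t _ _ = previous-apart< s<t t≤L hs ht
        ... | tri≈ _ s≡t _ = contradiction s≡t s≢t
        ... | tri> _ _ t<s with t≢s , ¬ts ← previous-apart< t<s s≤L ht hs = t≢s ∘ sym , ¬ts ∘ adj-sym G

        -- The predecessors form a family of size `∣ S ∣` that must be smaller than `∣ S ∣`. The two
        -- components required by toughness come from `h` and another element of `A⁺`.
        absurd : ⊥
        absurd = ℕ.<-irrefl refl (apart-family<∣S∣ G S
            (λ x∉ y∉ z∉ → nonhubs-transitive G A⁺ free A! independent 2≤k 2k<∣A∣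
              (¬hub x∉) (¬hub y∉) (¬hub z∉))
            tough {h} {proj₁ other} (∉S h-¬hub) (∉S (isolated-¬hub (independent (proj₁ (proj₂ other)))))
            (proj₂ (proj₂ other) , independent (here refl) (proj₁ (proj₂ other)))
            (previous ∘ pos) (λ i → ∉S (previous-¬hub (pos≤L i) (pos-hub i))) apart)
          where
          S : Subset n
          S = comprehension (hub? G A⁺)
          ∉S : ∀ {v} → ¬ isHub v → v ∉ S
          ∉S ¬h v∈ = ¬h (∈-comprehension⁻ (hub? G A⁺) v∈)
          ¬hub : ∀ {v} → v ∉ S → ¬ isHub v
          ¬hub v∉ h = v∉ (∈-comprehension⁺ (hub? G A⁺) h)
          found : ∀ i → ∃[ t ] t ≤ L × p t ≡ elements S i
          found i = hub-on-path (∈-comprehension⁻ (hub? G A⁺) (elements-∈ S i))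
          pos : Fin ∣ S ∣ → ℕ
          pos i = proj₁ (found i)
          pos≤L : ∀ i → pos i ≤ L
          pos≤L i = proj₁ (proj₂ (found i))
          pos-hub : ∀ i → isHub (p (pos i))
          pos-hub i = subst isHub (sym (proj₂ (proj₂ (found i)))) (∈-comprehension⁻ (hub? G A⁺) (elements-∈ S i))
          apart : ∀ {i j} → i ≢ j → Apart G (previous (pos i)) (previous (pos j))
          apart {i} {j} i≢j = previous-apart (pos≤L i) (pos≤L j) (pos-hub i) (pos-hub j)
            (λ e → i≢j (elements-injective S
              (trans (sym (proj₂ (proj₂ (found i)))) (trans (cong p e) (proj₂ (proj₂ (found j)))))))
          other : ∃[ a ] a ∈ˡ A⁺ × h ≢ a
          other = unique-second A! (ℕ.≤-trans 2≤k (ℕ.≤-trans (ℕ.m≤m+n k _) (ℕ.<⇒≤ 2k<∣A∣)))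

    no-maximal-nonspanning-path : ⊥
    no-maximal-nonspanning-path = attached-positions λ (I , I! , spec , len) → absurd I I! spec len

-- Lengthening paths until they span.

module _ (G : Graph (Fin n)) (2≤k : 2 ≤ k)
  (connected : IsConnected (2 * k + 1) G)
  (free : G isFreeOf (path 3 ∪ᵍ copies k (path 1)))
  (tough : ToughnessGreaterThan 1ℚ G) {u v : Fin n} (u≢v : u ≢ v) (¬ham : ¬ HamiltonianPath G u v) where

  -- Induction on the room `m` left for lengthening takes the place of choosing a longest path: the
  -- induction hypothesis rules out longer paths, which is the maximality needed to refute a
  -- non-spanning one.
  ¬simple-path : ∀ m {ps} → n ≤ length ps + m → Walk G u v ps → ¬ Unique ps
  ¬simple-path m {ps} n≤ w ps! with Fin.all? (λ x → _∈ˡ?_ Fin._≟_ x ps)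
  ... | yes span = ¬ham (record
    { vertices = ps ; linked = walk-linked w ; starts = walk-head w ; ends = walk-last w
    ; unique = ps! ; spanning = span })
  ... | no ¬span with h , h∉ ← Fin.¬∀⟶∃¬ n _ (λ x → _∈ˡ?_ Fin._≟_ x ps) ¬span with L , len , pL≡v ← walk-at-last u w =
    no-maximal-nonspanning-path G 2≤k connected free tough p L 0<L
      (λ t<L → walk-at-step u w (subst (_ <_) (sym len) (s≤s t<L)))
      (λ s≤L t≤L → at-injective u ps! (bound s≤L) (bound t≤L))
      on-or-off longer h (λ _ t≤L → λ { refl → h∉ (at-∈ u (bound t≤L)) })
    where
    p = at u ps
    bound : ∀ {t} → t ≤ L → t < length ps
    bound t≤L = subst (_ <_) (sym len) (s≤s t≤L)
    0<L : 0 < L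
    0<L = ℕ.n≢0⇒n>0 λ { refl → u≢v (trans (sym (walk-at-0 u w)) pL≡v) }
    on-or-off : ∀ x → (∃[ t ] t ≤ L × p t ≡ x) ⊎ (∀ t → t ≤ L → p t ≢ x)
    on-or-off x with _∈ˡ?_ Fin._≟_ x ps
    ... | yes x∈ with t , t< , e ← ∈-at u x∈ = inj₁ (t , ℕ.≤-pred (subst (t <_) len t<) , e)
    ... | no  x∉ = inj₂ λ _ t≤L → λ { refl → x∉ (at-∈ u (bound t≤L)) }
    vertices≡ps : interval p 0 L ≡ ps
    vertices≡ps = trans (cong (run p 0) (sym len)) (run-at u ps)
    longer : ∀ {hs} → Route G (p 0) (p L) (interval p 0 L ++ hs) → Unique hs →
      (∀ {x} → x ∈ˡ hs → ∀ t → t ≤ L → p t ≢ x) → ¬ 0 < length hs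
    longer {hs} (qs , w′ , e) hs! off 0<∣hs∣ = recurse m n≤
      where
      e′ : qs ↭ ps ++ hs
      e′ = subst (λ xs → qs ↭ xs ++ hs) vertices≡ps e
      qs! : Unique qs
      qs! = ↭ₛ.Unique-resp-↭ (setoid (Fin n)) (↭⇒↭ₛ (↭-sym e′)) (Unique.++⁺ ps! hs!
        (λ (x∈ps , x∈hs) → let t , t< , px = ∈-at u x∈ps in off x∈hs _ (ℕ.≤-pred (subst (t <_) len t<)) px))
      w″ : Walk G u v qs
      w″ = subst₂ (λ x y → Walk G x y qs) (walk-at-0 u w) pL≡v w′
      ∣ps∣<∣qs∣ : length ps < length qs
      ∣ps∣<∣qs∣ = subst (length ps <_) (sym (trans (↭-length e′) (List.length-++ ps)))
        (subst (_≤ length ps + length hs) (ℕ.+-comm (length ps) 1) (ℕ.+-monoʳ-≤ (length ps) 0<∣hs∣))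
      recurse : ∀ m → n ≤ length ps + m → ⊥
      -- With no room left, the longer path would have more than `n` distinct vertices.
      recurse zero n≤ = ℕ.<⇒≱ ∣ps∣<∣qs∣ (ℕ.≤-trans (unique⇒length≤n qs!) (subst (n ≤_) (ℕ.+-identityʳ _) n≤))
      recurse (suc m) n≤ = ¬simple-path m (ℕ.≤-trans n≤ (ℕ.≤-trans (ℕ.≤-reflexive (ℕ.+-suc _ m)) (ℕ.+-monoˡ-≤ m ∣ps∣<∣qs∣))) w″ qs!

  -- Otherwise the empty set is a cut, contradicting connectivity at least `2k + 1`.
  ¬¬reachable : ¬ ¬ Star (Adj G) u v
  ¬¬reachable ¬r = contradiction (ℕ.≤-trans (ℕ.m≤n+m 1 (2 * k)) (subst (2 * k + 1 ≤_) (∣⊥∣≡0 n)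
    (connected⇒≤cut G connected Subset.⊥ ((u , x∉p⇒x∈∁p ∉⊥) , (v , x∉p⇒x∈∁p ∉⊥) , ¬r ∘ Star.gmap proj₁ id)))) λ ()

  nonhamiltonian-absurd : ⊥
  nonhamiltonian-absurd = ¬¬reachable λ r → let ps , w , ps! , _ = erase-loops G id r in
    ¬simple-path n (ℕ.m≤n+m n (length ps)) w ps!

theorem1p2 : (k : ℕ) → 2 ≤ k →
    (n : ℕ) (G : Graph (Fin n)) →
    IsConnected (2 * k + 1) G →
    G isFreeOf (path 3 ∪ᵍ copies k (path 1)) →
    ToughnessGreaterThan 1ℚ G →
    HamiltonianConnected G
theorem1p2 k 2≤k n G connected free tough u v u≢v with hamiltonianPath? G u v
... | yes ham = ham
... | no ¬ham = ⊥-elim (nonhamiltonian-absurd G 2≤k connected free tough u≢v ¬ham)
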